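{- Let $X$ be a definable set in the ordered Fraenkel–Mostowski model $\mathbf{ZFA}(\mathcal{Q})$ of set theory with atoms. Then its Stone–Čech compactification $\overline{X}$ is definable.
   Context: $\mathcal{Q}=\langle\mathbb{Q},\le\rangle$ is the rationals with their natural order. $\mathbf{ZFA}(\mathcal{Q})$ is the permutation model with atoms $\mathbb{Q}$ consisting of hereditarily finitely supported sets (supported by finite $A_0$ = fixed by all order-automorphisms fixing $A_0$ pointwise). A set is definable if for some finite $A_0$ it is supported by $A_0$ and has finitely many orbits under automorphisms fixing $A_0$ pointwise. $\overline{X}$ is the set of finitely supported ultrafilters on the Boolean algebra of finitely supported subsets of $X$. -}

module Defs where

open import Data.Empty using (⊥)
open import Data.List.Base using (List)
open import Data.List.Membership.Propositional using () renaming (_∈_ to _∈ₗ_)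
open import Data.List.Relation.Unary.All using (All)
open import Data.List.Relation.Unary.Any using (Any)
open import Data.Product.Base using (Σ; ∃; ∃-syntax; _×_; proj₁)
open import Data.Rational.Base using (ℚ; _≤_)
open import Data.Sum.Base using (_⊎_)
open import Data.Unit.Base using (⊤)
open import Function.Bundles using (_⇔_)
open import Relation.Binary.Morphism.Structures using (IsOrderIsomorphism)
open import Relation.Binary.PropositionalEquality.Core using (_≡_)
open import Relation.Nullary.Negation.Core using (¬_)

infix 4 _≈_ _∈_ _∉_ _⊆_
infixl 7 _∩_ _∖_
infixr 8 _·_

-- The cumulative hierarchy of sets with atoms ℚ, in Aczel's style: a set is
-- presented by a family of elements, and equality of sets is the
-- extensional relation _≈_, not _≡_.
data V : Set₁ where
  atom : ℚ → V
  set  : (I : Set) → (I → V) → V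

_≈_ : V → V → Set
atom a  ≈ atom b  = a ≡ b
atom _  ≈ set _ _ = ⊥
set _ _ ≈ atom _  = ⊥
set I f ≈ set J g = (∀ i → ∃[ j ] f i ≈ g j) × (∀ j → ∃[ i ] f i ≈ g j)

_∈_ : V → V → Set
x ∈ atom _  = ⊥
x ∈ set I f = ∃[ i ] x ≈ f i

_∉_ : V → V → Set
x ∉ y = ¬ (x ∈ y)

-- Atoms have no elements, but they are not sets.
IsSet : V → Set
IsSet (atom _)  = ⊥
IsSet (set _ _) = ⊤

_⊆_ : V → V → Set₁
x ⊆ y = ∀ z → z ∈ x → z ∈ y

∅ : V
∅ = set ⊥ λ ()

-- Separation {z ∈ x | P z}; P is meant to respect _≈_, as it does in the
-- two instances below.
separate : V → (V → Set) → V
separate (atom _)  P = ∅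
separate (set I f) P = set (Σ I λ i → P (f i)) λ p → f (proj₁ p)

_∩_ : V → V → V
x ∩ y = separate x (_∈ y)

_∖_ : V → V → V
x ∖ y = separate x (_∉ y)

record Aut : Set where
  field
    ⟦_⟧                : ℚ → ℚ
    isOrderIsomorphism : IsOrderIsomorphism _≡_ _≡_ _≤_ _≤_ ⟦_⟧

open Aut public using (⟦_⟧)

_·_ : Aut → V → V
π · atom a  = atom (⟦ π ⟧ a)
π · set I f = set I λ i → π · f i

-- A finite set of atoms is given by a list enumerating it.
Fixes : List ℚ → Aut → Set
Fixes A π = ∀ a → a ∈ₗ A → ⟦ π ⟧ a ≡ a

Supports : List ℚ → V → Set
Supports A x = ∀ π → Fixes A π → π · x ≈ x

FinitelySupported : V → Set
FinitelySupported x = ∃[ A ] Supports A x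

-- Membership in ZFA(𝒬): the hereditarily finitely supported elements of V.
ZFA𝒬 : V → Set
ZFA𝒬 (atom _)  = ⊤
ZFA𝒬 (set I f) = FinitelySupported (set I f) × (∀ i → ZFA𝒬 (f i))

SameOrbit : List ℚ → V → V → Set
SameOrbit A x y = ∃[ π ] Fixes A π × π · x ≈ y

-- The elements of X fall into finitely many orbits under the automorphisms
-- fixing A pointwise: a list of representatives, possibly with repetitions.
FinitelyManyOrbits : List ℚ → V → Set₁
FinitelyManyOrbits A X =
  ∃[ xs ] All (_∈ X) xs × (∀ y → y ∈ X → Any (λ x → SameOrbit A x y) xs)

record Definable (X : V) : Set₁ where
  field
    isSet   : IsSet X
    inModel : ZFA𝒬 X
    finite  : ∃[ A ] Supports A X × FinitelyManyOrbits A X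

record IsFSSubset (X S : V) : Set₁ where
  field
    isSet             : IsSet S
    subset            : S ⊆ X
    finitelySupported : FinitelySupported S

-- U is an ultrafilter on the Boolean algebra of finitely supported subsets
-- of X.
record IsUltrafilter (X U : V) : Set₁ where
  field
    isSet        : IsSet U
    elements     : ∀ S → S ∈ U → IsFSSubset X S
    whole        : X ∈ U
    proper       : ∅ ∉ U
    intersection : ∀ S T → S ∈ U → T ∈ U → S ∩ T ∈ U
    upward       : ∀ S T → S ∈ U → IsFSSubset X T → S ⊆ T → T ∈ U
    ultra        : ∀ S → IsFSSubset X S → S ∈ U ⊎ X ∖ S ∈ U

-- βX is the set of finitely supported ultrafilters; by extensionality this
-- determines βX up to _≈_.
record IsStoneČech (X βX : V) : Set₁ where
  field
    isSet : IsSet βX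
    mem   : ∀ U → U ∈ βX ⇔ (IsUltrafilter X U × FinitelySupported U)

{-# OPTIONS --safe #-}

-- Every x ∈ X has a least support N, and an automorphism fixing x fixes N
-- pointwise; so the elements π x of the A-orbit of x have well-defined
-- coordinates π b, b ∈ N. A finitely supported ultrafilter U on X contains one
-- of the finitely many A-orbits, say that of x, and decides for every b ∈ N and
-- d ∈ ℚ whether the coordinate b is below, at or above d. By finite support and
-- monotonicity each coordinate thus converges to one of q⁻, q, q⁺ or ±∞. By
-- homogeneity of ℚ these limits determine U: close enough to them, all points
-- lie in one orbit over any given finite set. Up to automorphisms fixing A there
-- are only finitely many tuples of limits, hence finitely many orbits of
-- ultrafilters, which also makes their collection small enough to be a set.
module Submission where

open import Defs
open import Axiom.ExcludedMiddle using (ExcludedMiddle)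
open import Data.Empty using (⊥; ⊥-elim)
open import Data.Fin.Base using (Fin)
open import Data.List.Base using (List; []; _∷_; map; _++_; length; filter; lookup; cartesianProduct)
open import Data.List.Membership.Propositional using () renaming (_∈_ to _∈ₗ_)
open import Data.List.Membership.Propositional.Properties using (∈-map⁺; ∈-map⁻; ∈-filter⁺; ∈-filter⁻; ∈-++⁺ˡ; ∈-++⁺ʳ; ∈-++⁻; ∈-cartesianProduct⁺; ∈-cartesianProduct⁻; ∈-lookup)
open import Data.List.Properties using (filter-notAll)
open import Data.List.Relation.Unary.All as All using (All; []; _∷_)
import Data.List.Relation.Unary.All.Properties as All
open import Data.List.Relation.Unary.Any as Any using (Any; here; there)
import Data.List.Relation.Unary.Any.Properties as Any
open import Data.Nat.Base as ℕ using (zero; suc)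
import Data.Nat.Properties as ℕₚ
open import Data.Product.Base using (∃; ∃-syntax; _×_; _,_; proj₁; proj₂)
open import Data.Rational.Base using (ℚ; _≤_; _<_; _+_; _*_; _-_; -_; 1/_; 0ℚ; 1ℚ; Positive; positive; NonZero)
open import Data.Rational.Properties
open import Data.List.Membership.DecPropositional _≟_ using (_∈?_)
open import Data.Sum.Base as Sum using (_⊎_; inj₁; inj₂)
open import Data.Unit.Base using (tt)
open import Function.Base using (_∘_; const)
open import Function.Bundles using (mk⇔)
open import Level using (0ℓ)
open import Relation.Binary.Definitions using (tri<; tri≈; tri>)
open import Relation.Binary.Morphism.Structures using (IsOrderIsomorphism)
open import Relation.Binary.PropositionalEquality using (_≡_; refl; sym; trans; cong; cong₂; subst; subst₂; module ≡-Reasoning)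
open import Relation.Nullary.Decidable using (yes; no; ¬?)
open import Relation.Nullary.Negation.Core using (¬_)

-- Three-way comparison of rationals

data Ord : Set where
  lt eq gt : Ord

-- Comparison is a value and not a relation, so that two finite configurations have the same order
-- type when a family of equations holds.
cmp : ℚ → ℚ → Ord
cmp p q with <-cmp p q
... | tri< _ _ _ = lt
... | tri≈ _ _ _ = eq
... | tri> _ _ _ = gt

cmp-lt : ∀ {p q} → p < q → cmp p q ≡ lt
cmp-lt {p} {q} p<q with <-cmp p q
... | tri< _ _ _   = refl
... | tri≈ p≮q _ _ = ⊥-elim (p≮q p<q)
... | tri> p≮q _ _ = ⊥-elim (p≮q p<q)

cmp-refl : ∀ {p} → cmp p p ≡ eq
cmp-refl {p} with <-cmp p p
... | tri< _ p≢p _ = ⊥-elim (p≢p refl)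
... | tri≈ _ _ _   = refl
... | tri> _ p≢p _ = ⊥-elim (p≢p refl)

cmp-gt : ∀ {p q} → q < p → cmp p q ≡ gt
cmp-gt {p} {q} q<p with <-cmp p q
... | tri< _ _ q≮p = ⊥-elim (q≮p q<p)
... | tri≈ _ _ q≮p = ⊥-elim (q≮p q<p)
... | tri> _ _ _   = refl

lt⇒< : ∀ {p q} → cmp p q ≡ lt → p < q
lt⇒< {p} {q} e with <-cmp p q
lt⇒< e  | tri< p<q _ _ = p<q
lt⇒< () | tri≈ _ _ _
lt⇒< () | tri> _ _ _

eq⇒≡ : ∀ {p q} → cmp p q ≡ eq → p ≡ q
eq⇒≡ {p} {q} e with <-cmp p q
eq⇒≡ () | tri< _ _ _
eq⇒≡ e  | tri≈ _ p≡q _ = p≡q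
eq⇒≡ () | tri> _ _ _

gt⇒> : ∀ {p q} → cmp p q ≡ gt → q < p
gt⇒> {p} {q} e with <-cmp p q
gt⇒> () | tri< _ _ _
gt⇒> () | tri≈ _ _ _
gt⇒> e  | tri> _ _ q<p = q<p

cmp-mono : ∀ (f : ℚ → ℚ) → (∀ {p q} → p < q → f p < f q) →
           ∀ p q → cmp (f p) (f q) ≡ cmp p q
cmp-mono f f-mono p q with <-cmp p q
... | tri< p<q _ _  = cmp-lt (f-mono p<q)
... | tri≈ _ refl _ = cmp-refl
... | tri> _ _ q<p  = cmp-gt (f-mono q<p)

flip : Ord → Ord
flip lt = gt
flip eq = eq
flip gt = lt

cmp-flip : ∀ p q → cmp q p ≡ flip (cmp p q)
cmp-flip p q with <-cmp p q
... | tri< p<q _ _  = cmp-gt p<q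
... | tri≈ _ refl _ = cmp-refl
... | tri> _ _ q<p  = cmp-lt q<p

_≟ₒ_ : (s t : Ord) → s ≡ t ⊎ ¬ s ≡ t
lt ≟ₒ lt = inj₁ refl
lt ≟ₒ eq = inj₂ λ ()
lt ≟ₒ gt = inj₂ λ ()
eq ≟ₒ lt = inj₂ λ ()
eq ≟ₒ eq = inj₁ refl
eq ≟ₒ gt = inj₂ λ ()
gt ≟ₒ lt = inj₂ λ ()
gt ≟ₒ eq = inj₂ λ ()
gt ≟ₒ gt = inj₁ refl

-- Automorphisms of ⟨ℚ, ≤⟩

-- On a linear order, strict monotonicity already yields injectivity and reflection of the order;
-- the right inverse `g` supplies surjectivity.
mkAut : (f g : ℚ → ℚ) → (∀ p → f (g p) ≡ p) → (∀ {p q} → p < q → f p < f q) → Aut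
mkAut f g fg f-mono = record
  { ⟦_⟧ = f
  ; isOrderIsomorphism = record
    { isOrderMonomorphism = record
      { isOrderHomomorphism = record { cong = cong f ; mono = mono }
      ; injective = injective
      ; cancel = cancel
      }
    ; surjective = λ p → g p , λ { refl → fg p }
    }
  }
  where
  mono : ∀ {p q} → p ≤ q → f p ≤ f q
  mono {p} {q} p≤q with <-cmp p q
  ... | tri< p<q _ _  = <⇒≤ (f-mono p<q)
  ... | tri≈ _ refl _ = ≤-refl
  ... | tri> _ _ q<p  = ⊥-elim (<-irrefl refl (<-≤-trans q<p p≤q))
  injective : ∀ {p q} → f p ≡ f q → p ≡ q
  injective {p} {q} e = eq⇒≡ (trans (sym (cmp-mono f f-mono p q)) (trans (cong (cmp (f p)) (sym e)) cmp-refl))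
  cancel : ∀ {p q} → f p ≤ f q → p ≤ q
  cancel fp≤fq = ≮⇒≥ λ q<p → <-irrefl refl (<-≤-trans (f-mono q<p) fp≤fq)

private module Iso (π : Aut) = IsOrderIsomorphism (Aut.isOrderIsomorphism π)

Aut-mono : ∀ π {p q} → p < q → ⟦ π ⟧ p < ⟦ π ⟧ q
Aut-mono π {p} {q} p<q with <-cmp (⟦ π ⟧ p) (⟦ π ⟧ q)
... | tri< πp<πq _ _ = πp<πq
... | tri≈ _ e _     = ⊥-elim (<-irrefl (Iso.injective π e) p<q)
... | tri> _ _ πq<πp = ⊥-elim (<-irrefl refl (<-≤-trans p<q (Iso.cancel π (<⇒≤ πq<πp))))

cmp-Aut : ∀ π p q → cmp (⟦ π ⟧ p) (⟦ π ⟧ q) ≡ cmp p q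
cmp-Aut π = cmp-mono ⟦ π ⟧ (Aut-mono π)

inv : Aut → ℚ → ℚ
inv π p = proj₁ (Iso.surjective π p)

inverseʳ : ∀ π p → ⟦ π ⟧ (inv π p) ≡ p
inverseʳ π p = proj₂ (Iso.surjective π p) refl

inverseˡ : ∀ π p → inv π (⟦ π ⟧ p) ≡ p
inverseˡ π p = Iso.injective π (inverseʳ π (⟦ π ⟧ p))

inv-mono : ∀ π {p q} → p < q → inv π p < inv π q
inv-mono π {p} {q} p<q = lt⇒< (trans (sym (cmp-Aut π (inv π p) (inv π q)))
  (trans (cong₂ cmp (inverseʳ π p) (inverseʳ π q)) (cmp-lt p<q)))

infixl 8 _∙_
infix 9 _⁻¹

ε : Aut
ε = mkAut (λ p → p) (λ p → p) (λ _ → refl) (λ p<q → p<q)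

_∙_ : Aut → Aut → Aut
π ∙ σ = mkAut (λ p → ⟦ π ⟧ (⟦ σ ⟧ p)) (λ p → inv σ (inv π p))
  (λ p → trans (cong ⟦ π ⟧ (inverseʳ σ _)) (inverseʳ π p))
  (λ p<q → Aut-mono π (Aut-mono σ p<q))

_⁻¹ : Aut → Aut
π ⁻¹ = mkAut (inv π) ⟦ π ⟧ (inverseˡ π) (inv-mono π)

Fixes-∙ : ∀ {A π σ} → Fixes A π → Fixes A σ → Fixes A (π ∙ σ)
Fixes-∙ {π = π} Fπ Fσ a a∈A = trans (cong ⟦ π ⟧ (Fσ a a∈A)) (Fπ a a∈A)

Fixes-⁻¹ : ∀ {A π} → Fixes A π → Fixes A (π ⁻¹)
Fixes-⁻¹ {π = π} Fπ a a∈A = trans (cong (inv π) (sym (Fπ a a∈A))) (inverseˡ π a)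

abstract
  -- Follow `π` up to `c` and `σ` beyond it. As they agree at `c`, the images of the two halves meet
  -- only at `⟦ π ⟧ c`, which is where the inverse switches.
  glue : (π σ : Aut) (c : ℚ) → ⟦ π ⟧ c ≡ ⟦ σ ⟧ c →
         ∃[ τ ] (∀ {p} → p ≤ c → ⟦ τ ⟧ p ≡ ⟦ π ⟧ p) × (∀ {p} → c ≤ p → ⟦ τ ⟧ p ≡ ⟦ σ ⟧ p)
  glue π σ c πc≡σc = mkAut f g fg f-mono , f-≤ , f-≥
    where
    f g : ℚ → ℚ
    f p with p ≤? c
    ... | yes _ = ⟦ π ⟧ p
    ... | no  _ = ⟦ σ ⟧ p
    g p with p ≤? ⟦ π ⟧ c
    ... | yes _ = inv π p
    ... | no  _ = inv σ p
    f-≤ : ∀ {p} → p ≤ c → f p ≡ ⟦ π ⟧ p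
    f-≤ {p} p≤c with p ≤? c
    ... | yes _  = refl
    ... | no p≰c = ⊥-elim (p≰c p≤c)
    f-≥ : ∀ {p} → c ≤ p → f p ≡ ⟦ σ ⟧ p
    f-≥ {p} c≤p with p ≤? c
    ... | no _    = refl
    ... | yes p≤c rewrite ≤-antisym p≤c c≤p = πc≡σc
    f-mono : ∀ {p q} → p < q → f p < f q
    f-mono {p} {q} p<q with p ≤? c | q ≤? c
    ... | yes _   | yes _   = Aut-mono π p<q
    ... | no _    | no _    = Aut-mono σ p<q
    ... | no p≰c  | yes q≤c = ⊥-elim (p≰c (≤-trans (<⇒≤ p<q) q≤c))
    ... | yes p≤c | no q≰c  =
      ≤-<-trans (subst (⟦ π ⟧ p ≤_) πc≡σc (Iso.mono π p≤c)) (Aut-mono σ (≰⇒> q≰c))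
    fg : ∀ p → f (g p) ≡ p
    fg p with p ≤? ⟦ π ⟧ c
    ... | yes p≤πc = trans (f-≤ (Iso.cancel π (subst (_≤ ⟦ π ⟧ c) (sym (inverseʳ π p)) p≤πc))) (inverseʳ π p)
    ... | no  p≰πc = trans (f-≥ (Iso.cancel σ (subst₂ _≤_ πc≡σc (sym (inverseʳ σ p)) (<⇒≤ (≰⇒> p≰πc))))) (inverseʳ σ p)

translate : ℚ → Aut
translate t = mkAut (t +_) (- t +_)
  (λ p → trans (sym (+-assoc t (- t) p)) (trans (cong (_+ p) (+-inverseʳ t)) (+-identityˡ p)))
  (+-monoʳ-< t)

scale : ∀ {k} → 0ℚ < k → Aut
scale {k} 0<k = mkAut (k *_) (1/ k *_)
  (λ p → trans (sym (*-assoc k (1/ k) p)) (trans (cong (_* p) (*-inverseʳ k)) (*-identityˡ p)))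
  (*-monoʳ-<-pos k)
  where
  instance
    k>0 : Positive k
    k>0 = positive 0<k
    k≢0 = pos⇒nonZero k

0<- : ∀ {p q} → p < q → 0ℚ < - p + q
0<- {p} {q} p<q = subst (_< - p + q) (+-inverseˡ p) (+-monoʳ-< (- p) p<q)

abstract
  affine : ∀ {p p′ q q′} → p < p′ → q < q′ → ∃[ π ] ⟦ π ⟧ p ≡ q × ⟦ π ⟧ p′ ≡ q′
  affine {p} {p′} {q} {q′} p<p′ q<q′ =
    -- From right to left, `p` and `p′` go to 0 and `- p + p′`, then to 0 and 1, to 0 and
    -- `- q + q′`, and finally to `q` and `q′`.
    translate q ∙ scale (0<- q<q′) ∙ scale (0<- p<p′) ⁻¹ ∙ translate p ⁻¹ ,
    trans (cong (λ x → q + (- q + q′) * (r * x)) (+-inverseˡ p))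
      (trans (cong (λ x → q + (- q + q′) * x) (*-zeroʳ r))
        (trans (cong (q +_) (*-zeroʳ (- q + q′))) (+-identityʳ q))) ,
    trans (cong (λ x → q + (- q + q′) * x) (*-inverseˡ (- p + p′)))
      (trans (cong (q +_) (*-identityʳ (- q + q′))) (inverseʳ (translate q) q′))
    where
    instance
      Δp>0 : Positive (- p + p′)
      Δp>0 = positive (0<- p<p′)
      Δp≢0 : NonZero (- p + p′)
      Δp≢0 = pos⇒nonZero (- p + p′)
    r : ℚ
    r = 1/ (- p + p′)

  unbounded-below : ∀ p → ∃ (_< p)
  unbounded-below p = p - 1ℚ , subst (p - 1ℚ <_) (+-identityʳ p) (+-monoʳ-< p (negative⁻¹ (- 1ℚ)))

  unbounded-above : ∀ p → ∃ (p <_)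
  unbounded-above p = p + 1ℚ , subst (_< p + 1ℚ) (+-identityʳ p) (+-monoʳ-< p (positive⁻¹ 1ℚ))

-- Extension of finite partial isomorphisms

_≺_ : ℚ × ℚ → ℚ × ℚ → Set
(p , q) ≺ (p′ , q′) = p < p′ × q < q′

data Increasing : List (ℚ × ℚ) → Set where
  []  : Increasing []
  [_] : ∀ x → Increasing (x ∷ [])
  _∷_ : ∀ {x y L} → x ≺ y → Increasing (y ∷ L) → Increasing (x ∷ y ∷ L)

Realised : List (ℚ × ℚ) → Aut → Set
Realised L π = ∀ {p q} → (p , q) ∈ₗ L → ⟦ π ⟧ p ≡ q

Increasing⇒≤ : ∀ {x y L} → Increasing (x ∷ L) → y ∈ₗ x ∷ L → proj₁ x ≤ proj₁ y
Increasing⇒≤ _             (here refl) = ≤-refl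
Increasing⇒≤ (x≺y ∷ y∷L↗) (there z∈)   = ≤-trans (<⇒≤ (proj₁ x≺y)) (Increasing⇒≤ y∷L↗ z∈)

-- Piecewise linear interpolation: an affine map for the first segment is glued to the interpolation
-- of the remaining pairs at their common point `p′`.
extend-increasing : ∀ {L} → Increasing L → ∃ (Realised L)
extend-increasing [] = ε , λ ()
extend-increasing [ p , q ] with affine (proj₂ (unbounded-above p)) (proj₂ (unbounded-above q))
... | π , πp≡q , _ = π , λ { (here refl) → πp≡q ; (there ()) }
extend-increasing {(p , q) ∷ (p′ , q′) ∷ L} ((p<p′ , q<q′) ∷ L↗)
  with affine p<p′ q<q′ | extend-increasing L↗
... | π , πp≡q , πp′≡q′ | σ , σ-ok with glue π σ p′ (trans πp′≡q′ (sym (σ-ok (here refl))))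
... | τ , τ-≤ , τ-≥ = τ , λ where
  (here refl) → trans (τ-≤ (<⇒≤ p<p′)) πp≡q
  (there z∈)  → trans (τ-≥ (Increasing⇒≤ L↗ z∈)) (σ-ok z∈)

Compatible : ℚ × ℚ → ℚ × ℚ → Set
Compatible (p , q) (p′ , q′) = cmp p p′ ≡ cmp q q′

data Position (x y : ℚ × ℚ) : Set where
  before : x ≺ y → Position x y
  same   : x ≡ y → Position x y
  after  : y ≺ x → Position x y

position : ∀ x y → Compatible x y → Position x y
position (p , q) (p′ , q′) e with <-cmp p p′
... | tri< p<p′ _ _ = before (p<p′ , lt⇒< (sym e))
... | tri≈ _ refl _ = same (cong (p ,_) (eq⇒≡ (sym e)))
... | tri> _ _ p′<p = after (p′<p , gt⇒> (sym e))

-- The last component strengthens the induction: when `x` belongs after the head `y`, it allows `y`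
-- to be put back in front of the enlarged tail.
insert : ∀ x {L} → Increasing L → (∀ {y} → y ∈ₗ L → Compatible x y) →
         ∃[ L′ ] Increasing L′ × (∀ {y} → y ∈ₗ x ∷ L → y ∈ₗ L′) × (∀ {y} → y ∈ₗ L′ → y ∈ₗ x ∷ L)
         × (∀ {z} → z ≺ x → Increasing (z ∷ L) → Increasing (z ∷ L′))
insert x [] _ = x ∷ [] , [ x ] , (λ y∈ → y∈) , (λ y∈ → y∈) , λ z≺x _ → z≺x ∷ [ x ]
insert x {y ∷ L} L↗ x~L with position x y (x~L (here refl))
... | before x≺y = x ∷ y ∷ L , x≺y ∷ L↗ , (λ y∈ → y∈) , (λ y∈ → y∈) , λ z≺x _ → z≺x ∷ x≺y ∷ L↗
... | same refl  = y ∷ L , L↗ , (λ { (here refl) → here refl ; (there z∈) → z∈ }) , there , λ _ z∷L↗ → z∷L↗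
... | after y≺x with insert x (tail L↗) (λ z∈ → x~L (there z∈))
  where
  tail : ∀ {y L} → Increasing (y ∷ L) → Increasing L
  tail [ _ ]   = []
  tail (_ ∷ r) = r
... | L′ , _ , to , from , cons =
  y ∷ L′ , cons y≺x L↗ ,
  (λ { (here refl) → there (to (here refl)) ; (there (here refl)) → here refl ; (there (there z∈)) → there (to (there z∈)) }) ,
  (λ { (here refl) → there (here refl) ; (there z∈) → swap (from z∈) }) ,
  λ { _ (z≺y ∷ _) → z≺y ∷ cons y≺x L↗ }
  where
  swap : ∀ {z} → z ∈ₗ x ∷ L → z ∈ₗ x ∷ y ∷ L
  swap (here e)   = here e
  swap (there z∈) = there (there z∈)

sort : ∀ L → (∀ {x y} → x ∈ₗ L → y ∈ₗ L → Compatible x y) →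
       ∃[ L′ ] Increasing L′ × (∀ {y} → y ∈ₗ L → y ∈ₗ L′) × (∀ {y} → y ∈ₗ L′ → y ∈ₗ L)
sort [] _ = [] , [] , (λ y∈ → y∈) , λ y∈ → y∈
sort (x ∷ L) L~ with sort L (λ y∈ z∈ → L~ (there y∈) (there z∈))
... | L₁ , L₁↗ , to₁ , from₁ with insert x L₁↗ (λ y∈ → L~ (here refl) (there (from₁ y∈)))
... | L₂ , L₂↗ , to₂ , from₂ , _ = L₂ , L₂↗ ,
  (λ { (here refl) → to₂ (here refl) ; (there y∈) → to₂ (there (to₁ y∈)) }) ,
  (λ y∈ → back (from₂ y∈))
  where
  back : ∀ {y} → y ∈ₗ x ∷ L₁ → y ∈ₗ x ∷ L
  back (here e)   = here e
  back (there y∈) = there (from₁ y∈)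

-- Homogeneity of ℚ: compatible pairs can be sorted, with duplicates collapsing, into an increasing
-- list, which interpolation realises.
extend : ∀ L → (∀ {x y} → x ∈ₗ L → y ∈ₗ L → Compatible x y) → ∃ (Realised L)
extend L L~ with sort L L~
... | L′ , L′↗ , to , _ with extend-increasing L′↗
... | π , π-ok = π , λ pq∈L → π-ok (to pq∈L)

-- Indexing allows points of different origin, such as given rationals and coordinates, to be listed
-- side by side and to coincide.
extend-family : {I : Set} (J : List I) (u v : I → ℚ) →
                (∀ {i j} → i ∈ₗ J → j ∈ₗ J → cmp (u i) (u j) ≡ cmp (v i) (v j)) →
                ∃[ π ] (∀ {i} → i ∈ₗ J → ⟦ π ⟧ (u i) ≡ v i)
extend-family J u v e = π , λ i∈J → π-ok (∈-map⁺ _ i∈J)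
  where
  pairs~ : ∀ {x y} → x ∈ₗ map (λ i → u i , v i) J → y ∈ₗ map (λ i → u i , v i) J → Compatible x y
  pairs~ x∈ y∈ with ∈-map⁻ _ x∈ | ∈-map⁻ _ y∈
  ... | i , i∈ , refl | j , j∈ , refl = e i∈ j∈
  ext = extend (map (λ i → u i , v i) J) pairs~
  π = proj₁ ext
  π-ok = proj₂ ext

-- Sets and their images under automorphisms

≈-refl : ∀ x → x ≈ x
≈-refl (atom _)  = refl
≈-refl (set I f) = (λ i → i , ≈-refl (f i)) , (λ i → i , ≈-refl (f i))

≈-sym : ∀ x y → x ≈ y → y ≈ x
≈-sym (atom _)  (atom _)  e = sym e
≈-sym (set I f) (set J g) (fg , gf) =
  (λ j → let i , e = gf j in i , ≈-sym (f i) (g j) e) ,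
  (λ i → let j , e = fg i in j , ≈-sym (f i) (g j) e)

≈-trans : ∀ x y z → x ≈ y → y ≈ z → x ≈ z
≈-trans (atom _)  (atom _)  (atom _)  e e′ = trans e e′
≈-trans (set I f) (set J g) (set K h) (fg , gf) (gh , hg) =
  (λ i → let j , e = fg i ; k , e′ = gh j in k , ≈-trans (f i) (g j) (h k) e e′) ,
  (λ k → let j , e′ = hg k ; i , e = gf j in i , ≈-trans (f i) (g j) (h k) e e′)

·-cong : ∀ π x y → x ≈ y → π · x ≈ π · y
·-cong π (atom _)  (atom _)  e = cong ⟦ π ⟧ e
·-cong π (set I f) (set J g) (fg , gf) =
  (λ i → let j , e = fg i in j , ·-cong π (f i) (g j) e) ,
  (λ j → let i , e = gf j in i , ·-cong π (f i) (g j) e)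

·-ext : ∀ π σ x → (∀ a → ⟦ π ⟧ a ≡ ⟦ σ ⟧ a) → π · x ≈ σ · x
·-ext π σ (atom a)  e = e a
·-ext π σ (set I f) e = (λ i → i , ·-ext π σ (f i) e) , (λ i → i , ·-ext π σ (f i) e)

·-∙ : ∀ π σ x → (π ∙ σ) · x ≈ π · σ · x
·-∙ π σ (atom _)  = refl
·-∙ π σ (set I f) = (λ i → i , ·-∙ π σ (f i)) , (λ i → i , ·-∙ π σ (f i))

·-ε : ∀ x → ε · x ≈ x
·-ε (atom _)  = refl
·-ε (set I f) = (λ i → i , ·-ε (f i)) , (λ i → i , ·-ε (f i))

·-∙-ext : ∀ π σ τ x → (∀ a → ⟦ π ⟧ (⟦ σ ⟧ a) ≡ ⟦ τ ⟧ a) → π · σ · x ≈ τ · x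
·-∙-ext π σ τ x e = ≈-trans (π · σ · x) ((π ∙ σ) · x) (τ · x)
  (≈-sym ((π ∙ σ) · x) (π · σ · x) (·-∙ π σ x)) (·-ext (π ∙ σ) τ x e)

·-inverseˡ : ∀ π x → π ⁻¹ · π · x ≈ x
·-inverseˡ π x = ≈-trans (π ⁻¹ · π · x) (ε · x) x (·-∙-ext (π ⁻¹) π ε x (inverseˡ π)) (·-ε x)

·-inverseʳ : ∀ π x → π · π ⁻¹ · x ≈ x
·-inverseʳ π x = ≈-trans (π · π ⁻¹ · x) (ε · x) x (·-∙-ext π (π ⁻¹) ε x (inverseʳ π)) (·-ε x)

·-move : ∀ π x y → π · x ≈ y → x ≈ π ⁻¹ · y
·-move π x y e = ≈-trans x (π ⁻¹ · π · x) (π ⁻¹ · y)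
  (≈-sym (π ⁻¹ · π · x) x (·-inverseˡ π x)) (·-cong (π ⁻¹) (π · x) y e)

·-fix⁻¹ : ∀ π x → π · x ≈ x → π ⁻¹ · x ≈ x
·-fix⁻¹ π x e = ≈-sym x (π ⁻¹ · x) (·-move π x x e)

∈-respˡ : ∀ {x y} z → x ≈ y → x ∈ z → y ∈ z
∈-respˡ {x} {y} (set I f) e (i , x≈fi) = i , ≈-trans y x (f i) (≈-sym x y e) x≈fi

∈-respʳ : ∀ x {y z} → y ≈ z → x ∈ y → x ∈ z
∈-respʳ x {set I f} {set J g} (fg , _) (i , x≈fi) =
  let j , e = fg i in j , ≈-trans x (f i) (g j) x≈fi e

∈-· : ∀ π {x} y → x ∈ y → π · x ∈ π · y
∈-· π {x} (set I f) (i , x≈fi) = i , ·-cong π x (f i) x≈fi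

∈-·⁻ : ∀ π x y → x ∈ π · y → π ⁻¹ · x ∈ y
∈-·⁻ π x y x∈πy = ∈-respʳ (π ⁻¹ · x) (·-inverseˡ π y) (∈-· (π ⁻¹) (π · y) x∈πy)

∈-·⁺ : ∀ π x y → π ⁻¹ · x ∈ y → x ∈ π · y
∈-·⁺ π x y π⁻¹x∈y = ∈-respˡ (π · y) (·-inverseʳ π x) (∈-· π y π⁻¹x∈y)

-- `IsSet` excludes atoms, which have no elements and so are included in everything.
⊆-antisym : ∀ {x y} → IsSet x → IsSet y → x ⊆ y → y ⊆ x → x ≈ y
⊆-antisym {set I f} {set J g} _ _ x⊆y y⊆x =
  (λ i → x⊆y (f i) (i , ≈-refl (f i))) ,
  (λ j → let i , e = y⊆x (g j) (j , ≈-refl (g j)) in i , ≈-sym (g j) (f i) e)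

IsSet-resp : ∀ {x y} → x ≈ y → IsSet x → IsSet y
IsSet-resp {set _ _} {set _ _} _ _ = tt

IsSet-· : ∀ π {x} → IsSet x → IsSet (π · x)
IsSet-· π {set _ _} _ = tt

IsSet-separate : ∀ x P → IsSet (separate x P)
IsSet-separate (atom _)  P = tt
IsSet-separate (set _ _) P = tt

∈-separate⁺ : ∀ z x {P} → (∀ {u v} → u ≈ v → P u → P v) → z ∈ x → P z → z ∈ separate x P
∈-separate⁺ z (set I f) P-resp (i , e) Pz = (i , P-resp e Pz) , e

∈-separate⁻ : ∀ z x {P} → (∀ {u v} → u ≈ v → P u → P v) → z ∈ separate x P → z ∈ x × P z
∈-separate⁻ z (set I f) P-resp ((i , Pfi) , e) = (i , e) , P-resp (≈-sym z (f i) e) Pfi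

∈-∩⁺ : ∀ z x y → z ∈ x → z ∈ y → z ∈ x ∩ y
∈-∩⁺ z x y = ∈-separate⁺ z x (∈-respˡ y)

∈-∩⁻ : ∀ z x y → z ∈ x ∩ y → z ∈ x × z ∈ y
∈-∩⁻ z x y = ∈-separate⁻ z x (∈-respˡ y)

∉-respˡ : ∀ {x y} z → x ≈ y → x ∉ z → y ∉ z
∉-respˡ {x} {y} z e x∉z y∈z = x∉z (∈-respˡ z (≈-sym x y e) y∈z)

∈-∖⁺ : ∀ z x y → z ∈ x → z ∉ y → z ∈ x ∖ y
∈-∖⁺ z x y = ∈-separate⁺ z x (∉-respˡ y)

∈-∖⁻ : ∀ z x y → z ∈ x ∖ y → z ∈ x × z ∉ y
∈-∖⁻ z x y = ∈-separate⁻ z x (∉-respˡ y)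

·-∩ : ∀ π x y → π · (x ∩ y) ≈ (π · x) ∩ (π · y)
·-∩ π x y = ⊆-antisym (IsSet-· π (IsSet-separate x _)) (IsSet-separate (π · x) _)
  (λ z z∈ → let z∈x , z∈y = ∈-∩⁻ (π ⁻¹ · z) x y (∈-·⁻ π z (x ∩ y) z∈)
            in ∈-∩⁺ z (π · x) (π · y) (∈-·⁺ π z x z∈x) (∈-·⁺ π z y z∈y))
  (λ z z∈ → let z∈x , z∈y = ∈-∩⁻ z (π · x) (π · y) z∈
            in ∈-·⁺ π z (x ∩ y) (∈-∩⁺ (π ⁻¹ · z) x y (∈-·⁻ π z x z∈x) (∈-·⁻ π z y z∈y)))

·-∖ : ∀ π x y → π · (x ∖ y) ≈ (π · x) ∖ (π · y)
·-∖ π x y = ⊆-antisym (IsSet-· π (IsSet-separate x _)) (IsSet-separate (π · x) _)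
  (λ z z∈ → let z∈x , z∉y = ∈-∖⁻ (π ⁻¹ · z) x y (∈-·⁻ π z (x ∖ y) z∈)
            in ∈-∖⁺ z (π · x) (π · y) (∈-·⁺ π z x z∈x) (z∉y ∘ ∈-·⁻ π z y))
  (λ z z∈ → let z∈x , z∉y = ∈-∖⁻ z (π · x) (π · y) z∈
            in ∈-·⁺ π z (x ∖ y) (∈-∖⁺ (π ⁻¹ · z) x y (∈-·⁻ π z x z∈x) (z∉y ∘ ∈-·⁺ π z y)))

∖-congˡ : ∀ {x x′} y → x ≈ x′ → x ∖ y ≈ x′ ∖ y
∖-congˡ {x} {x′} y e = ⊆-antisym (IsSet-separate x _) (IsSet-separate x′ _)
  (λ z z∈ → let z∈x , z∉y = ∈-∖⁻ z x y z∈ in ∈-∖⁺ z x′ y (∈-respʳ z e z∈x) z∉y)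
  (λ z z∈ → let z∈x , z∉y = ∈-∖⁻ z x′ y z∈ in ∈-∖⁺ z x y (∈-respʳ z (≈-sym x x′ e) z∈x) z∉y)

-- Supports

Supports-resp : ∀ {A x y} → x ≈ y → Supports A x → Supports A y
Supports-resp {A} {x} {y} e supp π Fπ = ≈-trans (π · y) (π · x) y
  (·-cong π y x (≈-sym x y e)) (≈-trans (π · x) x y (supp π Fπ) e)

-- If `σ` fixes the image of `A` under `π`, then its conjugate `ρ` by `π` fixes `A`, and `σ ∙ π`
-- acts as `π ∙ ρ`.
Supports-· : ∀ {A} π x → Supports A x → Supports (map ⟦ π ⟧ A) (π · x)
Supports-· {A} π x supp σ Fσ =
  ≈-trans (σ · π · x) (π · ρ · x) (π · x)
    (≈-trans (σ · π · x) ((σ ∙ π) · x) (π · ρ · x)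
      (≈-sym ((σ ∙ π) · x) (σ · π · x) (·-∙ σ π x))
      (≈-sym (π · ρ · x) ((σ ∙ π) · x) (·-∙-ext π ρ (σ ∙ π) x (λ a → inverseʳ π _))))
    (·-cong π (ρ · x) x (supp ρ ρ-fixes))
  where
  ρ = π ⁻¹ ∙ (σ ∙ π)
  ρ-fixes : Fixes A ρ
  ρ-fixes a a∈A = trans (cong (inv π) (Fσ _ (∈-map⁺ ⟦ π ⟧ a∈A))) (inverseˡ π a)

FinitelySupported-resp : ∀ {x y} → x ≈ y → FinitelySupported x → FinitelySupported y
FinitelySupported-resp e (A , supp) = A , Supports-resp e supp

FinitelySupported-· : ∀ π x → FinitelySupported x → FinitelySupported (π · x)
FinitelySupported-· π x (A , supp) = map ⟦ π ⟧ A , Supports-· π x supp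

Closed : List ℚ → V → Set₁
Closed A S = ∀ π → Fixes A π → ∀ z → z ∈ S → π · z ∈ S

-- Closure under `π` gives one inclusion; closure under `π ⁻¹`, which fixes `A` as well, gives the
-- other.
Closed⇒Supports : ∀ {A S} → IsSet S → Closed A S → Supports A S
Closed⇒Supports {A} {S} isSet closed π Fπ = ⊆-antisym (IsSet-· π isSet) isSet
  (λ z z∈πS → ∈-respˡ S (·-inverseʳ π z) (closed π Fπ (π ⁻¹ · z) (∈-·⁻ π z S z∈πS)))
  (λ z z∈S → ∈-·⁺ π z S (closed (π ⁻¹) (Fixes-⁻¹ {π = π} Fπ) z z∈S))

Supports⇒Closed : ∀ {A S} → Supports A S → Closed A S
Supports⇒Closed {A} {S} supp π Fπ z z∈S = ∈-respʳ (π · z) (supp π Fπ) (∈-· π S z∈S)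

ZFA-resp : ∀ x y → x ≈ y → ZFA𝒬 x → ZFA𝒬 y
ZFA-resp (atom _)  (atom _)  _ _ = tt
ZFA-resp (set I f) (set J g) e@(_ , gf) (fs , fI) = FinitelySupported-resp e fs ,
  λ j → let i , fi≈gj = gf j in ZFA-resp (f i) (g j) fi≈gj (fI i)

ZFA⇒FinitelySupported : ∀ x → ZFA𝒬 x → FinitelySupported x
ZFA⇒FinitelySupported (atom a)  _        = (a ∷ []) , λ π Fπ → Fπ a (here refl)
ZFA⇒FinitelySupported (set _ _) (fs , _) = fs

∈-ZFA : ∀ z x → z ∈ x → ZFA𝒬 x → ZFA𝒬 z
∈-ZFA z (set I f) (i , e) (_ , fI) = ZFA-resp (f i) z (≈-sym z (f i) e) (fI i)

-- Transport of ultrafilters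

IsFSSubset-resp : ∀ {X S T} → S ≈ T → IsFSSubset X S → IsFSSubset X T
IsFSSubset-resp {X} {S} {T} e fss = record
  { isSet = IsSet-resp e isSet
  ; subset = λ z z∈T → subset z (∈-respʳ z (≈-sym S T e) z∈T)
  ; finitelySupported = FinitelySupported-resp e finitelySupported
  } where open IsFSSubset fss

IsFSSubset-· : ∀ {X S} π → π · X ≈ X → IsFSSubset X S → IsFSSubset X (π · S)
IsFSSubset-· {X} {S} π e fss = record
  { isSet = IsSet-· π isSet
  ; subset = λ z z∈πS → ∈-respʳ z e (∈-·⁺ π z X (subset (π ⁻¹ · z) (∈-·⁻ π z S z∈πS)))
  ; finitelySupported = FinitelySupported-· π S finitelySupported
  } where open IsFSSubset fss

-- A set `S` is in `W` just when `π ⁻¹ · S` is in `U`, so every axiom is pulled back along `π ⁻¹`,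
-- which preserves `X`.
IsUltrafilter-· : ∀ {X U W} π → π · X ≈ X → W ≈ π · U → IsUltrafilter X U → IsUltrafilter X W
IsUltrafilter-· {X} {U} {W} π πX≈X W≈πU ult = record
  { isSet        = IsSet-resp (≈-sym W (π · U) W≈πU) (IsSet-· π isSet)
  ; elements     = λ S S∈W → IsFSSubset-resp (·-inverseʳ π S) (IsFSSubset-· π πX≈X (elements _ (to S S∈W)))
  ; whole        = from X (∈-respˡ U (≈-sym (π ⁻¹ · X) X π⁻¹X≈X) whole)
  ; proper       = λ ∅∈W → proper (∈-respˡ {π ⁻¹ · ∅} {∅} U ((λ ()) , λ ()) (to ∅ ∅∈W))
  ; intersection = λ S T S∈W T∈W → from (S ∩ T)
      (∈-respˡ U (≈-sym (π ⁻¹ · (S ∩ T)) _ (·-∩ (π ⁻¹) S T)) (intersection _ _ (to S S∈W) (to T T∈W)))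
  ; upward       = λ S T S∈W T-fss S⊆T → from T (upward (π ⁻¹ · S) (π ⁻¹ · T) (to S S∈W)
      (IsFSSubset-· (π ⁻¹) π⁻¹X≈X T-fss)
      λ z z∈ → ∈-·⁺ (π ⁻¹) z T (S⊆T ((π ⁻¹) ⁻¹ · z) (∈-·⁻ (π ⁻¹) z S z∈)))
  ; ultra        = λ S S-fss → Sum.map (from S)
      (λ X∖S∈U → from (X ∖ S) (∈-respˡ U (≈-sym (π ⁻¹ · (X ∖ S)) (X ∖ (π ⁻¹ · S))
        (≈-trans (π ⁻¹ · (X ∖ S)) ((π ⁻¹ · X) ∖ (π ⁻¹ · S)) (X ∖ (π ⁻¹ · S))
          (·-∖ (π ⁻¹) X S) (∖-congˡ (π ⁻¹ · S) π⁻¹X≈X))) X∖S∈U))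
      (ultra (π ⁻¹ · S) (IsFSSubset-· (π ⁻¹) π⁻¹X≈X S-fss))
  }
  where
  open IsUltrafilter ult
  π⁻¹X≈X = ·-fix⁻¹ π X πX≈X
  to : ∀ S → S ∈ W → π ⁻¹ · S ∈ U
  to S S∈W = ∈-·⁻ π S U (∈-respʳ S W≈πU S∈W)
  from : ∀ S → π ⁻¹ · S ∈ U → S ∈ W
  from S S∈U = ∈-respʳ S (≈-sym W (π · U) W≈πU) (∈-·⁺ π S U S∈U)

-- Least supports

-- Having the same position relative to `M` makes the pair `(p , q)` compatible with the identity on
-- `M`, and homogeneity applies.
move : ∀ M {p q} → (∀ {m} → m ∈ₗ M → cmp p m ≡ cmp q m) → ∃[ π ] Fixes M π × ⟦ π ⟧ p ≡ q
move M {p} {q} e = π , (λ a a∈M → π-ok (there (∈-map⁺ _ a∈M))) , π-ok (here refl)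
  where
  L = (p , q) ∷ map (λ m → m , m) M
  e′ : ∀ {m} → m ∈ₗ M → cmp m p ≡ cmp m q
  e′ {m} m∈M = trans (cmp-flip p m) (trans (cong flip (e m∈M)) (sym (cmp-flip q m)))
  L~ : ∀ {x y} → x ∈ₗ L → y ∈ₗ L → Compatible x y
  L~ (here refl) (here refl) = trans cmp-refl (sym cmp-refl)
  L~ (here refl) (there y∈) with ∈-map⁻ _ y∈
  ... | m , m∈M , refl = e m∈M
  L~ (there x∈) (here refl) with ∈-map⁻ _ x∈
  ... | m , m∈M , refl = e′ m∈M
  L~ (there x∈) (there y∈) with ∈-map⁻ _ x∈ | ∈-map⁻ _ y∈
  ... | _ , _ , refl | _ , _ , refl = refl
  ext = extend L L~
  π = proj₁ ext
  π-ok = proj₂ ext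

upper-bound : ∀ {p q r} → p < r → q < r → ∃[ u ] p ≤ u × q ≤ u × u < r
upper-bound {p} {q} p<r q<r with ≤-total p q
... | inj₁ p≤q = q , p≤q , ≤-refl , q<r
... | inj₂ q≤p = p , ≤-refl , q≤p , p<r

lower-bound : ∀ {p q r} → r < p → r < q → ∃[ u ] u ≤ p × u ≤ q × r < u
lower-bound {p} {q} r<p r<q with ≤-total p q
... | inj₁ p≤q = p , ≤-refl , p≤q , r<p
... | inj₂ q≤p = q , q≤p , ≤-refl , r<q

-- The interval is open, so each point of `M` other than `a` may itself serve as an endpoint; the
-- endpoints closest to `a` are kept.
isolate : ∀ M a → ∃[ l ] ∃[ r ] l < a × a < r ×
          (∀ {m d} → m ∈ₗ M → ¬ m ≡ a → l < d → d < r → cmp d m ≡ cmp a m)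
isolate [] a = proj₁ (unbounded-below a) , proj₁ (unbounded-above a) ,
  proj₂ (unbounded-below a) , proj₂ (unbounded-above a) , λ ()
isolate (m ∷ M) a with isolate M a | <-cmp m a
... | l , r , l<a , a<r , iso | tri≈ _ m≡a _ = l , r , l<a , a<r , λ where
  (here refl) m≢a _ _ → ⊥-elim (m≢a m≡a)
  (there m∈)          → iso m∈
... | l , r , l<a , a<r , iso | tri< m<a _ _ with upper-bound l<a m<a
... | l′ , l≤l′ , m≤l′ , l′<a = l′ , r , l′<a , a<r , λ where
  (here refl) _ l′<d _  → trans (cmp-gt (≤-<-trans m≤l′ l′<d)) (sym (cmp-gt m<a))
  (there m∈) m≢a l′<d   → iso m∈ m≢a (≤-<-trans l≤l′ l′<d)
isolate (m ∷ M) a | l , r , l<a , a<r , iso | tri> _ _ a<m with lower-bound a<r a<m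
... | r′ , r′≤r , r′≤m , a<r′ = l , r′ , l<a , a<r′ , λ where
  (here refl) _ _ d<r′     → trans (cmp-lt (<-≤-trans d<r′ r′≤m)) (sym (cmp-lt a<m))
  (there m∈) m≢a l<d d<r′  → iso m∈ m≢a l<d (<-≤-trans d<r′ r′≤r)

between : ∀ {l r a c} → l < a → a < r → ¬ c ≡ a → ∃[ d ] l < d × d < r × cmp d a ≡ cmp c a
between {l} {r} {a} {c} l<a a<r c≢a with <-cmp c a
... | tri≈ _ c≡a _ = ⊥-elim (c≢a c≡a)
... | tri< _ _ _ with <-dense l<a
... | d , l<d , d<a = d , l<d , <-trans d<a a<r , cmp-lt d<a
between {l} {r} {a} {c} l<a a<r c≢a | tri> _ _ _ with <-dense a<r
... | d , a<d , d<r = d , <-trans l<a a<d , d<r , cmp-gt a<d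

remove : ℚ → List ℚ → List ℚ
remove a = filter (λ m → ¬? (m ≟ a))

∈-remove⁺ : ∀ {a m M} → m ∈ₗ M → ¬ m ≡ a → m ∈ₗ remove a M
∈-remove⁺ = ∈-filter⁺ _

∈-remove⁻ : ∀ {a m M} → m ∈ₗ remove a M → m ∈ₗ M × ¬ m ≡ a
∈-remove⁻ {a} = ∈-filter⁻ (λ m → ¬? (m ≟ a))

length-remove : ∀ {a M} → a ∈ₗ M → length (remove a M) ℕ.< length M
length-remove {a} {M} a∈M = filter-notAll _ M (Any.map (λ { refl ¬a≡a → ¬a≡a refl }) a∈M)

-- If π fixes M ∖ {a} and moves a to c, then near a there is d on the side of
-- c; an automorphism fixing M′ takes a to d, and one fixing M takes d to c.
Supports-remove : ∀ {M M′ a} x → Supports M x → Supports M′ x → ¬ a ∈ₗ M′ →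
                  Supports (remove a M) x
Supports-remove {M} {M′} {a} x M-supp M′-supp a∉M′ π Fπ with ⟦ π ⟧ a ≟ a
... | yes πa≡a = M-supp π fixes
  where
  fixes : Fixes M π
  fixes m m∈M with m ≟ a
  ... | yes refl = πa≡a
  ... | no m≢a   = Fπ m (∈-remove⁺ m∈M m≢a)
... | no πa≢a with isolate (M′ ++ remove a M) a
... | l , r , l<a , a<r , iso with between l<a a<r πa≢a
... | d , l<d , d<r , d~πa = result
  where
  c = ⟦ π ⟧ a
  ≢a : ∀ {m} → m ∈ₗ M′ ++ remove a M → ¬ m ≡ a
  ≢a m∈ m≡a with ∈-++⁻ M′ m∈
  ... | inj₁ m∈M′ = a∉M′ (subst (_∈ₗ M′) m≡a m∈M′)
  ... | inj₂ m∈K  = proj₂ (∈-remove⁻ {M = M} m∈K) m≡a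
  σ-move = move (M′ ++ remove a M) {a} {d} (λ m∈ → sym (iso m∈ (≢a m∈) l<d d<r))
  d~c : ∀ {m} → m ∈ₗ M → cmp d m ≡ cmp c m
  d~c {m} m∈M with m ≟ a
  ... | yes refl = d~πa
  ... | no m≢a   = trans (iso (∈-++⁺ʳ M′ m∈K) m≢a l<d d<r)
      (trans (sym (cmp-Aut π a m)) (cong (cmp c) (Fπ m m∈K)))
    where m∈K = ∈-remove⁺ m∈M m≢a
  ρ-move = move M d~c
  σ = proj₁ σ-move
  ρ = proj₁ ρ-move
  τ = ρ ∙ σ
  τ-fixes : Fixes (remove a M) τ
  τ-fixes m m∈K = trans (cong ⟦ ρ ⟧ (proj₁ (proj₂ σ-move) m (∈-++⁺ʳ M′ m∈K)))
                        (proj₁ (proj₂ ρ-move) m (proj₁ (∈-remove⁻ {M = M} m∈K)))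
  τa≡c : ⟦ τ ⟧ a ≡ c
  τa≡c = trans (cong ⟦ ρ ⟧ (proj₂ (proj₂ σ-move))) (proj₂ (proj₂ ρ-move))
  τx≈x : τ · x ≈ x
  τx≈x = ≈-trans (τ · x) (ρ · σ · x) x (·-∙ ρ σ x) (≈-trans (ρ · σ · x) (ρ · x) x
    (·-cong ρ (σ · x) x (M′-supp σ λ m m∈M′ → proj₁ (proj₂ σ-move) m (∈-++⁺ˡ m∈M′)))
    (M-supp ρ (proj₁ (proj₂ ρ-move))))
  -- On `M` the automorphisms `τ` and `π` agree: both send `a` to `c` and fix the other points.
  fixes : Fixes M (τ ⁻¹ ∙ π)
  fixes m m∈M with m ≟ a
  ... | yes refl = trans (cong (inv τ) (sym τa≡c)) (inverseˡ τ a)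
  ... | no m≢a   = Fixes-∙ {π = τ ⁻¹} {σ = π} (Fixes-⁻¹ {π = τ} τ-fixes) Fπ m (∈-remove⁺ m∈M m≢a)
  result : π · x ≈ x
  result = ≈-trans (π · x) (τ · (τ ⁻¹ ∙ π) · x) x
    (≈-sym (τ · (τ ⁻¹ ∙ π) · x) (π · x) (·-∙-ext τ (τ ⁻¹ ∙ π) π x λ p → inverseʳ τ _))
    (≈-trans (τ · (τ ⁻¹ ∙ π) · x) (τ · x) x (·-cong τ ((τ ⁻¹ ∙ π) · x) x (M-supp (τ ⁻¹ ∙ π) fixes)) τx≈x)

LeastSupport : List ℚ → V → Set
LeastSupport N x = Supports N x × (∀ M → Supports M x → ∀ n → n ∈ₗ N → n ∈ₗ M)

-- As long as some support misses a point `a` of `M`, that point can be removed from `M`. When no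
-- such support is left, `M` is contained in all of them. The bound `k` on the length ensures
-- termination.
least-support : ExcludedMiddle 0ℓ → ∀ x → FinitelySupported x → ∃[ N ] LeastSupport N x
least-support em x (A , A-supp) = go (length A) A ℕₚ.≤-refl A-supp
  where
  go : ∀ k M → length M ℕ.≤ k → Supports M x → ∃[ N ] LeastSupport N x
  go k M |M|≤k M-supp with em {∃[ M′ ] ∃[ a ] Supports M′ x × a ∈ₗ M × ¬ a ∈ₗ M′}
  ... | no minimal = M , M-supp , λ M′ M′-supp n n∈M → least M′ M′-supp n n∈M (n ∈? M′)
    where
    least : ∀ M′ → Supports M′ x → ∀ n → n ∈ₗ M → _ → n ∈ₗ M′
    least M′ M′-supp n n∈M (yes n∈M′) = n∈M′
    least M′ M′-supp n n∈M (no n∉M′)  = ⊥-elim (minimal (M′ , n , M′-supp , n∈M , n∉M′))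
  go zero    []      _     _      | yes (_ , _ , _ , () , _)
  go (suc k) M       |M|≤k M-supp | yes (M′ , a , M′-supp , a∈M , a∉M′) =
    go k (remove a M) (ℕ.s≤s⁻¹ (ℕₚ.≤-trans (length-remove a∈M) |M|≤k))
      (Supports-remove x M-supp M′-supp a∉M′)

-- The iterates of `n` would form an infinite ascending sequence in `N`. The list `L` contains the
-- elements of `N` above the current iterate and shrinks at each step.
no-ascent : ∀ π N → (∀ {n} → n ∈ₗ N → ⟦ π ⟧ n ∈ₗ N) → ∀ {n} → n ∈ₗ N → ¬ n < ⟦ π ⟧ n
no-ascent π N closed n∈N n<πn = go (length N) N ℕₚ.≤-refl n∈N n<πn λ m∈N _ → m∈N
  where
  go : ∀ k L → length L ℕ.≤ k → ∀ {n} → n ∈ₗ N → n < ⟦ π ⟧ n → (∀ {m} → m ∈ₗ N → n < m → m ∈ₗ L) → ⊥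
  go zero    []      _    n∈N n<πn above with above (closed n∈N) n<πn
  ... | ()
  go (suc k) L |L|≤k {n} n∈N n<πn above =
    go k (remove (⟦ π ⟧ n) L)
      (ℕ.s≤s⁻¹ (ℕₚ.≤-trans (length-remove (above (closed n∈N) n<πn)) |L|≤k))
      (closed n∈N) (Aut-mono π n<πn)
      λ m∈N πn<m → ∈-remove⁺ (above m∈N (<-trans n<πn πn<m)) λ { refl → <-irrefl refl πn<m }

-- The preimage of `N` under `π` supports `π ⁻¹ · x`, that is `x`, and hence contains the least
-- support `N`.
LeastSupport-preserved : ∀ {N} x → LeastSupport N x → ∀ π → π · x ≈ x → ∀ {n} → n ∈ₗ N → ⟦ π ⟧ n ∈ₗ N
LeastSupport-preserved {N} x (supp , least) π e {n} n∈N
  with ∈-map⁻ _ (least _ (Supports-resp (·-fix⁻¹ π x e) (Supports-· (π ⁻¹) x supp)) n n∈N)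
... | m , m∈N , refl = subst (_∈ₗ N) (sym (inverseʳ π m)) m∈N

-- A finite set preserved by an order automorphism is fixed pointwise.
LeastSupport-rigid : ∀ {N} x → LeastSupport N x → ∀ π → π · x ≈ x → Fixes N π
LeastSupport-rigid {N} x least π πx≈x n n∈N with <-cmp n (⟦ π ⟧ n)
... | tri≈ _ n≡πn _ = sym n≡πn
... | tri< n<πn _ _ = ⊥-elim (no-ascent π N (LeastSupport-preserved x least π πx≈x) n∈N n<πn)
... | tri> _ _ πn<n = ⊥-elim (no-ascent (π ⁻¹) N
    (LeastSupport-preserved x least (π ⁻¹) (·-fix⁻¹ π x πx≈x)) n∈N
    (subst (_< inv π n) (inverseˡ π n) (inv-mono π πn<n)))

Supports-agree : ∀ {N} x → Supports N x → ∀ π σ → (∀ n → n ∈ₗ N → ⟦ π ⟧ n ≡ ⟦ σ ⟧ n) → π · x ≈ σ · x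
Supports-agree x supp π σ e = ≈-trans (π · x) (σ · (σ ⁻¹ ∙ π) · x) (σ · x)
  (≈-sym (σ · (σ ⁻¹ ∙ π) · x) (π · x) (·-∙-ext σ (σ ⁻¹ ∙ π) π x λ p → inverseʳ σ _))
  (·-cong σ ((σ ⁻¹ ∙ π) · x) x (supp (σ ⁻¹ ∙ π) λ n n∈N → trans (cong (inv σ) (e n n∈N)) (inverseˡ σ n)))

-- By rigidity `σ ⁻¹ ∙ π`, which fixes `x`, fixes `N` pointwise. Thus the coordinates of a point in
-- the orbit of `x` do not depend on the automorphism leading to it.
LeastSupport-agree : ∀ {N} x → LeastSupport N x → ∀ π σ → π · x ≈ σ · x → ∀ n → n ∈ₗ N → ⟦ π ⟧ n ≡ ⟦ σ ⟧ n
LeastSupport-agree x least π σ e n n∈N =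
  trans (sym (inverseʳ σ _)) (cong ⟦ σ ⟧ (LeastSupport-rigid x least (σ ⁻¹ ∙ π) fixed n n∈N))
  where
  fixed : (σ ⁻¹ ∙ π) · x ≈ x
  fixed = ≈-trans ((σ ⁻¹ ∙ π) · x) (σ ⁻¹ · π · x) x (·-∙ (σ ⁻¹) π x)
    (≈-trans (σ ⁻¹ · π · x) (σ ⁻¹ · σ · x) x (·-cong (σ ⁻¹) (π · x) (σ · x) e) (·-inverseˡ σ x))

-- Cuts

no-exception : ∀ {A : Set} {g : A → Ord} {s} → ¬ (∃[ a ] ¬ g a ≡ s) → ∀ a → g a ≡ s
no-exception {g = g} {s} none a with g a ≟ₒ s
... | inj₁ ga≡s = ga≡s
... | inj₂ ga≢s = ⊥-elim (none (a , ga≢s))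

-- Think of `g d` as the position of one coordinate relative to `d`. With growing `d` it passes from
-- `gt` to `lt`, taking the value `eq` at most once.
module _ (em : ExcludedMiddle 0ℓ) (g : ℚ → Ord) (descending : ∀ {p q} → p < q → ¬ g p ≡ gt → g q ≡ lt) where

  gt-below : ∀ {p q} → p < q → ¬ g q ≡ lt → g p ≡ gt
  gt-below {p} p<q gq≢lt with g p ≟ₒ gt
  ... | inj₁ gp≡gt = gp≡gt
  ... | inj₂ gp≢gt = ⊥-elim (gq≢lt (descending p<q gp≢gt))

  Meets : List ℚ → Set
  Meets M = ∀ {p q} → g p ≡ gt → g q ≡ lt → ∃[ m ] m ∈ₗ M × p ≤ m × m ≤ q

  jump : ∀ M → Meets M → ∀ {p q} → g p ≡ gt → g q ≡ lt →
         ∃[ c ] (∀ {p} → p < c → g p ≡ gt) × (∀ {p} → c < p → g p ≡ lt)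
  jump [] meets gp gq with meets gp gq
  ... | _ , () , _
  jump (m ∷ M) meets gp gq with em {∃[ p ] p < m × ¬ g p ≡ gt}
  ... | yes (p₀ , p₀<m , gp₀≢gt) with <-dense p₀<m
  ... | f , p₀<f , f<m = jump M meets′ gp gq
    where
    below : ∀ {p q} → q < m → g p ≡ gt → g q ≡ lt → ∃[ k ] k ∈ₗ M × p ≤ k × k ≤ q
    below q<m gp gq with meets gp gq
    ... | _ , here refl , _ , m≤q  = ⊥-elim (<-irrefl refl (<-≤-trans q<m m≤q))
    ... | k , there k∈M , p≤k , k≤q = k , k∈M , p≤k , k≤q
    meets′ : Meets M
    meets′ {q = q} gp gq with q <? m
    ... | yes q<m = below q<m gp gq
    -- The interval reaches `m`, so it is cut off at `f`, to the left of `m`, where `g` is already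
    -- `lt`.
    ... | no q≮m with below f<m gp (descending p₀<f gp₀≢gt)
    ... | k , k∈M , p≤k , k≤f = k , k∈M , p≤k , ≤-trans k≤f (≤-trans (<⇒≤ f<m) (≮⇒≥ q≮m))
  jump (m ∷ M) meets gp gq | no all-gt with em {∃[ q ] m < q × ¬ g q ≡ lt}
  ... | yes (q₀ , m<q₀ , gq₀≢lt) with <-dense m<q₀
  ... | f , m<f , f<q₀ = jump M meets′ gp gq
    where
    above : ∀ {p q} → m < p → g p ≡ gt → g q ≡ lt → ∃[ k ] k ∈ₗ M × p ≤ k × k ≤ q
    above m<p gp gq with meets gp gq
    ... | _ , here refl , p≤m , _  = ⊥-elim (<-irrefl refl (<-≤-trans m<p p≤m))
    ... | k , there k∈M , p≤k , k≤q = k , k∈M , p≤k , k≤q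
    meets′ : Meets M
    meets′ {p = p} gp gq with m <? p
    ... | yes m<p = above m<p gp gq
    ... | no m≮p with above m<f (gt-below f<q₀ gq₀≢lt) gq
    ... | k , k∈M , f≤k , k≤q = k , k∈M , ≤-trans (≮⇒≥ m≮p) (≤-trans (<⇒≤ m<f) f≤k) , k≤q
  jump (m ∷ M) meets gp gq | no all-gt | no all-lt = m , below , above
    where
    below : ∀ {p} → p < m → g p ≡ gt
    below {p} p<m with g p ≟ₒ gt
    ... | inj₁ e = e
    ... | inj₂ ne = ⊥-elim (all-gt (p , p<m , ne))
    above : ∀ {p} → m < p → g p ≡ lt
    above {p} m<p with g p ≟ₒ lt
    ... | inj₁ e = e
    ... | inj₂ ne = ⊥-elim (all-lt (p , m<p , ne))

  -- Since `g` can only change across points of the finite list `M`, the cut lies at a rational or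
  -- at infinity and never at an irrational.
  cut : ∀ M → (∀ {p q} → p < q → (∀ {m} → m ∈ₗ M → m < p ⊎ q < m) → g p ≡ g q) →
        ∃[ c ] ∃[ F ] (∀ p → g p ≡ F (cmp p c))
  cut M constant with em {∃[ p ] ¬ g p ≡ gt} | em {∃[ p ] ¬ g p ≡ lt}
  -- The cut is at +∞ here and at -∞ in the next clause; in both, 0ℚ is an arbitrary choice.
  ... | no all-gt | _ = 0ℚ , const gt , no-exception all-gt
  ... | _ | no all-lt = 0ℚ , const lt , no-exception all-lt
  ... | yes (p₀ , p₀≢gt) | yes (q₀ , q₀≢lt)
    with jump M meets (gt-below (proj₂ (unbounded-below q₀)) q₀≢lt) (descending (proj₂ (unbounded-above p₀)) p₀≢gt)
    where
    search : ∀ L p q → (∃[ m ] m ∈ₗ L × p ≤ m × m ≤ q) ⊎ (∀ {m} → m ∈ₗ L → m < p ⊎ q < m)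
    search [] p q = inj₂ λ ()
    search (m ∷ L) p q with m <? p | q <? m | search L p q
    ... | _ | _ | inj₁ (k , k∈L , bounds) = inj₁ (k , there k∈L , bounds)
    ... | yes m<p | _ | inj₂ none = inj₂ λ { (here refl) → inj₁ m<p ; (there k∈L) → none k∈L }
    ... | no _ | yes q<m | inj₂ none = inj₂ λ { (here refl) → inj₂ q<m ; (there k∈L) → none k∈L }
    ... | no m≮p | no q≮m | inj₂ none = inj₁ (m , here refl , ≮⇒≥ m≮p , ≮⇒≥ q≮m)
    lt≢gt : ∀ {s} → s ≡ gt → s ≡ lt → ⊥
    lt≢gt refl ()
    meets : Meets M
    meets {p} {q} gp gq with search M p q
    ... | inj₁ found = found
    ... | inj₂ none with <-cmp p q
    ... | tri< p<q _ _  = ⊥-elim (lt≢gt gp (trans (constant p<q none) gq))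
    ... | tri≈ _ refl _ = ⊥-elim (lt≢gt gp gq)
    ... | tri> _ _ q<p  = ⊥-elim (lt≢gt gp (descending q<p λ gq′ → lt≢gt gq′ gq))
  ... | c , below , above = c , F , λ p → agrees p (<-cmp p c)
    where
    -- The value `g c` tells `c⁻` (`lt`), `c` (`eq`) and `c⁺` (`gt`) apart.
    F : Ord → Ord
    F lt = gt
    F eq = g c
    F gt = lt
    agrees : ∀ p → _ → g p ≡ F (cmp p c)
    agrees p (tri< p<c _ _)  = trans (below p<c) (cong F (sym (cmp-lt p<c)))
    agrees p (tri≈ _ refl _) = cong F (sym (cmp-refl {p}))
    agrees p (tri> _ _ c<p)  = trans (above c<p) (cong F (sym (cmp-gt c<p)))

-- Ultrafilters and their germs

Cond : Set
Cond = ℚ × ℚ × Ord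

Holds : Aut → Cond → Set
Holds π (b , d , s) = cmp (⟦ π ⟧ b) d ≡ s

Holds-∙ : ∀ ρ π {b d s} → Holds π (b , d , s) → Holds (ρ ∙ π) (b , ⟦ ρ ⟧ d , s)
Holds-∙ ρ π {b} {d} = trans (cmp-Aut ρ (⟦ π ⟧ b) d)

-- The part of the A-orbit of x on which the coordinates b of x stand in
-- prescribed order relations to given rationals.
piece : List ℚ → V → List Cond → V
piece A x cs = set (∃[ π ] Fixes A π × All (Holds π) cs) λ p → proj₁ p · x

inhabited : ExcludedMiddle 0ℓ → ∀ {X U} → IsUltrafilter X U → ∀ S → S ∈ U → ∃[ z ] z ∈ S
inhabited em {U = U} ult (atom a)  S∈U = ⊥-elim (IsFSSubset.isSet (IsUltrafilter.elements ult (atom a) S∈U))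
inhabited em {U = U} ult (set I f) S∈U with em {I}
... | yes i = f i , i , ≈-refl (f i)
... | no ¬i = ⊥-elim (IsUltrafilter.proper ult
  (∈-respˡ {set I f} {∅} U ((λ i → ⊥-elim (¬i i)) , λ ()) S∈U))

-- Each test has three outcomes: split `T` by the first test and recurse on the three subtypes.
-- Excluded middle picks a member of each inhabited class. The level is arbitrary because germs form
-- a large type.
representatives : ∀ {ℓ} → ExcludedMiddle ℓ → {T : Set ℓ} {I : Set} (test : T → I → Ord) (L : List I) →
                  ∃[ ts ] (∀ t → Any (λ t′ → ∀ i → i ∈ₗ L → test t′ i ≡ test t i) ts)
representatives em {T} test [] with em {T}
... | yes t = (t ∷ []) , λ _ → here λ _ ()
... | no ¬t = [] , λ t → ⊥-elim (¬t t)
representatives em {T} test (i ∷ L) =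
  reps lt ++ reps eq ++ reps gt , covers
  where
  class = λ s → representatives em {∃[ t ] test t i ≡ s} (test ∘ proj₁) L
  reps : Ord → List T
  reps s = map proj₁ (proj₁ (class s))
  Agrees : T → T → Set
  Agrees t t′ = ∀ j → j ∈ₗ i ∷ L → test t′ j ≡ test t j
  within : ∀ s t → test t i ≡ s → Any (Agrees t) (reps s)
  within s t e = Any.map⁺ (Any.map
    (λ { {t′ , e′} agree _ (here refl) → trans e′ (sym e) ; agree j (there j∈L) → agree j j∈L })
    (proj₂ (class s) (t , e)))
  covers : ∀ t → Any (Agrees t) (reps lt ++ reps eq ++ reps gt)
  covers t with test t i in e
  ... | lt = Any.++⁺ˡ (within lt t e)
  ... | eq = Any.++⁺ʳ (reps lt) (Any.++⁺ˡ (within eq t e))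
  ... | gt = Any.++⁺ʳ (reps lt) (Any.++⁺ʳ (reps eq) (within gt t e))

module _ {A : List ℚ} {X : V} (A-supp : Supports A X) where

  -- An automorphism `ρ` fixing `A` and the rationals named in `cs` turns a witness `π` into
  -- `ρ ∙ π`, which meets the same conditions.
  IsFSSubset-piece : ∀ {x} → x ∈ X → ∀ cs → IsFSSubset X (piece A x cs)
  IsFSSubset-piece {x} x∈X cs = record
    { isSet             = tt
    ; subset            = λ { z ((π , Fπ , _) , z≈πx) →
        ∈-respˡ X (≈-sym z (π · x) z≈πx) (Supports⇒Closed A-supp π Fπ x x∈X) }
    ; finitelySupported = A ++ map (proj₁ ∘ proj₂) cs , Closed⇒Supports tt closed
    }
    where
    closed : Closed (A ++ map (proj₁ ∘ proj₂) cs) (piece A x cs)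
    closed ρ Fρ z ((π , Fπ , hs) , z≈πx) =
      (ρ ∙ π , Fixes-∙ {π = ρ} {σ = π} (λ a a∈A → Fρ a (∈-++⁺ˡ a∈A)) Fπ , All.tabulate holds) ,
      ≈-trans (ρ · z) (ρ · π · x) ((ρ ∙ π) · x) (·-cong ρ z (π · x) z≈πx) (≈-sym ((ρ ∙ π) · x) (ρ · π · x) (·-∙ ρ π x))
      where
      holds : ∀ {c} → c ∈ₗ cs → Holds (ρ ∙ π) c
      holds {b , d , s} c∈cs = subst (λ d′ → cmp (⟦ ρ ⟧ (⟦ π ⟧ b)) d′ ≡ s)
        (Fρ d (∈-++⁺ʳ A (∈-map⁺ (proj₁ ∘ proj₂) c∈cs))) (Holds-∙ ρ π {b} {d} {s} (All.lookup hs c∈cs))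

  module _ {U : V} (em : ExcludedMiddle 0ℓ) (ult : IsUltrafilter X U) where
    open IsUltrafilter ult

    -- If `U` contained no orbit, it would contain the intersection of their complements; an element
    -- of that intersection lies in no orbit, although the orbits cover `X`.
    ultra-orbit : ∀ xs → All (_∈ X) xs → (∀ y → y ∈ X → Any (λ x → SameOrbit A x y) xs) →
                  Any (λ x → piece A x [] ∈ U) xs
    ultra-orbit xs xs∈X covers = Sum.[ (λ found → found) , none ] (search xs xs∈X)
      where
      Avoiding : List V → V → Set₁
      Avoiding ys S = ∀ z → z ∈ S → All (λ x → ¬ SameOrbit A x z) ys
      search : ∀ ys → All (_∈ X) ys →
               Any (λ x → piece A x [] ∈ U) ys ⊎ ∃[ S ] S ∈ U × Avoiding ys S
      search [] _ = inj₂ (X , whole , λ _ _ → [])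
      search (y ∷ ys) (y∈X ∷ ys∈X) with ultra (piece A y []) (IsFSSubset-piece y∈X []) | search ys ys∈X
      ... | inj₁ O∈U   | _                      = inj₁ (here O∈U)
      ... | inj₂ _     | inj₁ found             = inj₁ (there found)
      ... | inj₂ X∖O∈U | inj₂ (S , S∈U , avoid) =
        inj₂ ((X ∖ piece A y []) ∩ S , intersection _ _ X∖O∈U S∈U , λ z z∈ →
          let z∈X∖O , z∈S = ∈-∩⁻ z (X ∖ piece A y []) S z∈
              _ , z∉O     = ∈-∖⁻ z X (piece A y []) z∈X∖O
          in (λ { (π , Fπ , πy≈z) → z∉O ((π , Fπ , []) , ≈-sym (π · y) z πy≈z) }) ∷ avoid z z∈S)
      none : ∃[ S ] S ∈ U × Avoiding xs S → Any (λ x → piece A x [] ∈ U) xs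
      none (S , S∈U , avoid) =
        let z , z∈S = inhabited em ult S S∈U
        in ⊥-elim (All.All¬⇒¬Any (avoid z z∈S) (covers z (IsFSSubset.subset (elements S S∈U) z z∈S)))

    module _ {x : V} (x∈X : x ∈ X) (O∈U : piece A x [] ∈ U) where

      -- By trichotomy the three pieces cover the orbit, so their complements cannot all belong to
      -- `U`.
      decide : ∀ b d → ∃[ s ] piece A x ((b , d , s) ∷ []) ∈ U
      decide b d with side lt | side eq | side gt
        where side = λ s → ultra (piece A x ((b , d , s) ∷ [])) (IsFSSubset-piece x∈X _)
      ... | inj₁ ∈U | _ | _ = lt , ∈U
      ... | inj₂ _ | inj₁ ∈U | _ = eq , ∈U
      ... | inj₂ _ | inj₂ _ | inj₁ ∈U = gt , ∈U
      ... | inj₂ lt∉ | inj₂ eq∉ | inj₂ gt∉ = absurd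
          (inhabited em ult _ (intersection _ _ O∈U (intersection _ _ lt∉ (intersection _ _ eq∉ gt∉))))
        where
        co : Ord → V
        co s = X ∖ piece A x ((b , d , s) ∷ [])
        absurd : ∃[ z ] z ∈ piece A x [] ∩ (co lt ∩ (co eq ∩ co gt)) → _
        absurd (z , z∈) with ∈-∩⁻ z (piece A x []) (co lt ∩ (co eq ∩ co gt)) z∈
        ... | ((π , Fπ , _) , z≈πx) , z∈₁ with ∈-∩⁻ z (co lt) (co eq ∩ co gt) z∈₁
        ... | z∈lt , z∈₂ with ∈-∩⁻ z (co eq) (co gt) z∈₂
        ... | z∈eq , z∈gt with cmp (⟦ π ⟧ b) d in e
        ... | lt = ⊥-elim (proj₂ (∈-∖⁻ z X _ z∈lt) ((π , Fπ , e ∷ []) , z≈πx))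
        ... | eq = ⊥-elim (proj₂ (∈-∖⁻ z X _ z∈eq) ((π , Fπ , e ∷ []) , z≈πx))
        ... | gt = ⊥-elim (proj₂ (∈-∖⁻ z X _ z∈gt) ((π , Fπ , e ∷ []) , z≈πx))

      module _ {N : List ℚ} (least : LeastSupport N x) where

        -- A common element of two pieces comes with two automorphisms `π` and `σ`. They agree on
        -- the least support, so the condition met by `π` is met by `σ` too.
        piece-all : ∀ cs → (∀ {c} → c ∈ₗ cs → proj₁ c ∈ₗ N × piece A x (c ∷ []) ∈ U) → piece A x cs ∈ U
        piece-all [] _ = O∈U
        piece-all (c ∷ cs) large = upward _ _
          (intersection _ _ (proj₂ (large (here refl))) (piece-all cs (large ∘ there)))
          (IsFSSubset-piece x∈X (c ∷ cs)) both
          where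
          both : (piece A x (c ∷ []) ∩ piece A x cs) ⊆ piece A x (c ∷ cs)
          both z z∈ with ∈-∩⁻ z (piece A x (c ∷ [])) (piece A x cs) z∈
          ... | ((π , Fπ , h ∷ []) , z≈πx) , ((σ , Fσ , hs) , z≈σx) = (σ , Fσ , h′ ∷ hs) , z≈σx
            where
            h′ : Holds σ c
            h′ = subst (λ p → cmp p (proj₁ (proj₂ c)) ≡ proj₂ (proj₂ c))
              (LeastSupport-agree x least π σ
                (≈-trans (π · x) z (σ · x) (≈-sym z (π · x) z≈πx) z≈σx) (proj₁ c) (proj₁ (large (here refl)))) h

        -- Two decisions about one coordinate hold together at an actual rational, which reduces
        -- consistency of decisions to the order of ℚ.
        common : ∀ {b d s d′ s′} → b ∈ₗ N → piece A x ((b , d , s) ∷ []) ∈ U → piece A x ((b , d′ , s′) ∷ []) ∈ U →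
                 ∃[ p ] cmp p d ≡ s × cmp p d′ ≡ s′
        common {b} b∈N ∈U ∈U′ with inhabited em ult _ (piece-all (_ ∷ _ ∷ [])
          λ { (here refl) → b∈N , ∈U ; (there (here refl)) → b∈N , ∈U′ })
        ... | z , (π , _ , h ∷ h′ ∷ []) , _ = ⟦ π ⟧ b , h , h′

        limit-cut : FinitelySupported U → ∀ {b} → b ∈ₗ N →
                    ∃[ q ] ∃[ F ] (∀ d → piece A x ((b , d , F (cmp d q)) ∷ []) ∈ U)
        limit-cut (C , C-supp) {b} b∈N =
          let q , F , e = cut em g descending (A ++ C) constant
          in q , F , λ d → subst (λ s → piece A x ((b , d , s) ∷ []) ∈ U) (e d) (proj₂ (decide b d))
          where
          g : ℚ → Ord
          g d = proj₁ (decide b d)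
          descending : ∀ {d e} → d < e → ¬ g d ≡ gt → g e ≡ lt
          descending {d} {e} d<e gd≢gt with common b∈N (proj₂ (decide b d)) (proj₂ (decide b e))
          ... | p , pd , pe = trans (sym pe) (cmp-lt (below (g d) gd≢gt pd))
            where
            below : ∀ s → ¬ s ≡ gt → cmp p d ≡ s → p < e
            below lt _    h = <-trans (lt⇒< h) d<e
            below eq _    h = subst (_< e) (sym (eq⇒≡ h)) d<e
            below gt gt≢gt _ = ⊥-elim (gt≢gt refl)
          -- With no point of `A ++ C` between them, `d` is moved to `e` by some `ρ` fixing `A` and
          -- `C`. It preserves `U`, so the decision at `d` also holds at `e`.
          constant : ∀ {d e} → d < e → (∀ {c} → c ∈ₗ A ++ C → c < d ⊎ e < c) → g d ≡ g e
          constant {d} {e} d<e apart with move (A ++ C) {d} {e}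
            (λ c∈ → Sum.[ (λ c<d → trans (cmp-gt c<d) (sym (cmp-gt (<-trans c<d d<e))))
                        , (λ e<c → trans (cmp-lt (<-trans d<e e<c)) (sym (cmp-lt e<c))) ] (apart c∈))
          ... | ρ , Fρ , ρd≡e with common b∈N (proj₂ (decide b e)) moved
            where
            P = piece A x ((b , d , g d) ∷ [])
            ρP⊆ : (ρ · P) ⊆ piece A x ((b , e , g d) ∷ [])
            ρP⊆ z ((π , Fπ , h ∷ []) , z≈ρπx) =
              (ρ ∙ π , Fixes-∙ {π = ρ} {σ = π} (λ a a∈A → Fρ a (∈-++⁺ˡ a∈A)) Fπ ,
                subst (λ e → cmp (⟦ ρ ⟧ (⟦ π ⟧ b)) e ≡ g d) ρd≡e (Holds-∙ ρ π {b} {d} h) ∷ []) ,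
              ≈-trans z (ρ · π · x) ((ρ ∙ π) · x) z≈ρπx (≈-sym ((ρ ∙ π) · x) (ρ · π · x) (·-∙ ρ π x))
            moved : piece A x ((b , e , g d) ∷ []) ∈ U
            moved = upward (ρ · P) _
              (∈-respʳ (ρ · P) (C-supp ρ λ c c∈C → Fρ c (∈-++⁺ʳ A c∈C)) (∈-· ρ U (proj₂ (decide b d))))
              (IsFSSubset-piece x∈X _) ρP⊆
          ... | p , pe , pe′ = trans (sym pe′) pe

  -- The coordinate b of x converges to limit b, and shape b, a function of the
  -- position of d relative to limit b, is its generic position relative to d.
  -- The shape distinguishes q⁻, q, q⁺ and ±∞; at ±∞ it is constant and limit b
  -- is arbitrary.
  record Germ (x : V) (N : List ℚ) : Set₁ where
    field
      ultrafilter : V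
      ult         : IsUltrafilter X ultrafilter
      supported   : FinitelySupported ultrafilter
      orbit       : piece A x [] ∈ ultrafilter
      limit       : ℚ → ℚ
      shape       : ℚ → Ord → Ord
      converges   : ∀ {b} → b ∈ₗ N → ∀ d → piece A x ((b , d , shape b (cmp d (limit b))) ∷ []) ∈ ultrafilter

  germ : ExcludedMiddle 0ℓ → ∀ {x N} → x ∈ X → LeastSupport N x →
         ∀ U → IsUltrafilter X U → FinitelySupported U → piece A x [] ∈ U →
         ∃[ G ] Germ.ultrafilter {x} {N} G ≡ U
  germ em {x} {N} x∈X least U ult supported orbit = record
    { ultrafilter = U
    ; ult         = ult
    ; supported   = supported
    ; orbit       = orbit
    ; limit       = λ b → proj₁ (cut-at b)
    ; shape       = λ b → proj₁ (proj₂ (cut-at b))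
    ; converges   = λ {b} → proj₂ (proj₂ (cut-at b))
    } , refl
    where
    cut-at : ∀ b → ∃[ q ] ∃[ F ] (b ∈ₗ N → ∀ d → piece A x ((b , d , F (cmp d q)) ∷ []) ∈ U)
    cut-at b with b ∈? N
    ... | yes b∈N = let q , F , conv = limit-cut em ult x∈X orbit least supported b∈N in q , F , λ _ → conv
    -- Limits and shapes are total functions; outside `N` they take default values.
    ... | no b∉N  = 0ℚ , (λ s → s) , λ b∈N → ⊥-elim (b∉N b∈N)

  -- Germs up to automorphisms

  module _ (em : ExcludedMiddle 0ℓ) {x : V} (x∈X : x ∈ X) {N : List ℚ} (least : LeastSupport N x) where
    open Germ

    conditions : Germ x N → List ℚ → List Cond
    conditions G D = map (λ (b , d) → b , d , shape G b (cmp d (limit G b))) (cartesianProduct N D)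

    ∈-conditions : ∀ G {D b d} → b ∈ₗ N → d ∈ₗ D → (b , d , shape G b (cmp d (limit G b))) ∈ₗ conditions G D
    ∈-conditions G b∈N d∈D = ∈-map⁺ _ (∈-cartesianProduct⁺ b∈N d∈D)

    neighbourhood : ∀ G D → piece A x (conditions G D) ∈ ultrafilter G
    neighbourhood G D = piece-all em (ult G) x∈X (orbit G) least (conditions G D) large
      where
      large : ∀ {c} → c ∈ₗ conditions G D → proj₁ c ∈ₗ N × piece A x (c ∷ []) ∈ ultrafilter G
      large c∈ with ∈-map⁻ _ c∈
      ... | (b , d) , bd∈ , refl = let b∈N , _ = ∈-cartesianProduct⁻ N D bd∈ in b∈N , converges G b∈N d

    Matches : Aut → Germ x N → Germ x N → Set
    Matches ρ G H = ∀ {b} → b ∈ₗ N → ⟦ ρ ⟧ (limit G b) ≡ limit H b × (∀ s → shape G b s ≡ shape H b s)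

    -- A neighbourhood of the germ lies in a single orbit of the automorphisms
    -- fixing D, so it is contained in any D-supported set that it meets.
    transfer : ∀ ρ → Fixes A ρ → ∀ G H → Matches ρ G H → ∀ S → S ∈ ultrafilter G → ρ · S ∈ ultrafilter H
    transfer ρ Fρ G H match S S∈G with IsUltrafilter.elements (ult G) S S∈G
    ... | S-fss with IsFSSubset.finitelySupported S-fss
    ... | D , D-supp with inhabited em (ult G) _ (IsUltrafilter.intersection (ult G) _ _ S∈G (neighbourhood G D))
    ... | y , y∈ with ∈-∩⁻ y S (piece A x (conditions G D)) y∈
    ... | y∈S , (π , Fπ , hs) , y≈πx = IsUltrafilter.upward (ult H) _ (ρ · S)
        (neighbourhood H (map ⟦ ρ ⟧ D)) (IsFSSubset-· ρ (A-supp ρ Fρ) S-fss) contained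
      where
      contained : piece A x (conditions H (map ⟦ ρ ⟧ D)) ⊆ (ρ · S)
      contained z ((σ , Fσ , ks) , z≈σx) = ∈-respˡ (ρ · S) τρy≈z
          (Supports⇒Closed (Supports-· ρ S D-supp) τ τ-fixes (ρ · y) (∈-· ρ S y∈S))
        where
        -- The automorphism `τ` has to fix the image of `D` under `ρ` and to carry the coordinates
        -- of `ρ · y` to those of `z`: `u` gives the sources, `v` the targets.
        u v : ℚ ⊎ ℚ → ℚ
        u = Sum.[ ⟦ ρ ⟧ , ⟦ ρ ∙ π ⟧ ]
        v = Sum.[ ⟦ ρ ⟧ , ⟦ σ ⟧ ]
        K = map inj₁ D ++ map inj₂ N
        data InJ : ℚ ⊎ ℚ → Set where
          point : ∀ {d} → d ∈ₗ D → InJ (inj₁ d)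
          coord : ∀ {b} → b ∈ₗ N → InJ (inj₂ b)
        inJ : ∀ {i} → i ∈ₗ K → InJ i
        inJ i∈K with ∈-++⁻ (map inj₁ D) i∈K
        ... | inj₁ i∈ with ∈-map⁻ inj₁ i∈
        ... | _ , d∈D , refl = point d∈D
        inJ i∈K | inj₂ i∈ with ∈-map⁻ inj₂ i∈
        ... | _ , b∈N , refl = coord b∈N
        -- Both coordinates are in generic position, one for `G` and one for `H`, and `ρ` matches
        -- limits and shapes.
        same-side : ∀ {b d} → b ∈ₗ N → d ∈ₗ D → cmp (⟦ ρ ⟧ (⟦ π ⟧ b)) (⟦ ρ ⟧ d) ≡ cmp (⟦ σ ⟧ b) (⟦ ρ ⟧ d)
        same-side {b} {d} b∈N d∈D = begin
          cmp (⟦ ρ ⟧ (⟦ π ⟧ b)) (⟦ ρ ⟧ d)             ≡⟨ cmp-Aut ρ _ _ ⟩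
          cmp (⟦ π ⟧ b) d                             ≡⟨ All.lookup hs (∈-conditions G b∈N d∈D) ⟩
          shape G b (cmp d (limit G b))               ≡⟨ proj₂ (match b∈N) _ ⟩
          shape H b (cmp d (limit G b))               ≡⟨ cong (shape H b) (cmp-Aut ρ _ _) ⟨
          shape H b (cmp (⟦ ρ ⟧ d) (⟦ ρ ⟧ (limit G b))) ≡⟨ cong (λ q → shape H b (cmp (⟦ ρ ⟧ d) q)) (proj₁ (match b∈N)) ⟩
          shape H b (cmp (⟦ ρ ⟧ d) (limit H b))       ≡⟨ All.lookup ks (∈-conditions H b∈N (∈-map⁺ ⟦ ρ ⟧ d∈D)) ⟨
          cmp (⟦ σ ⟧ b) (⟦ ρ ⟧ d)                     ∎
          where open ≡-Reasoning
        compatible : ∀ {i j} → InJ i → InJ j → cmp (u i) (u j) ≡ cmp (v i) (v j)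
        compatible (point _)   (point _)   = refl
        compatible (coord b∈N) (point d∈D) = same-side b∈N d∈D
        compatible (point {d} d∈D) (coord {b} b∈N) = trans (cmp-flip (⟦ ρ ⟧ (⟦ π ⟧ b)) (⟦ ρ ⟧ d))
          (trans (cong flip (same-side b∈N d∈D)) (sym (cmp-flip (⟦ σ ⟧ b) (⟦ ρ ⟧ d))))
        compatible (coord {b} _) (coord {b′} _) = trans (cmp-Aut (ρ ∙ π) b b′) (sym (cmp-Aut σ b b′))
        ext = extend-family K u v λ i∈ j∈ → compatible (inJ i∈) (inJ j∈)
        τ = proj₁ ext
        τ-fixes : Fixes (map ⟦ ρ ⟧ D) τ
        τ-fixes a a∈ with ∈-map⁻ ⟦ ρ ⟧ a∈
        ... | d , d∈D , refl = proj₂ ext (∈-++⁺ˡ (∈-map⁺ inj₁ d∈D))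
        τρy≈z : τ · ρ · y ≈ z
        τρy≈z = ≈-trans (τ · ρ · y) (τ · ρ · π · x) z
          (·-cong τ (ρ · y) (ρ · π · x) (·-cong ρ y (π · x) y≈πx))
          (≈-trans (τ · ρ · π · x) ((τ ∙ (ρ ∙ π)) · x) z
            (≈-trans (τ · ρ · π · x) (τ · (ρ ∙ π) · x) ((τ ∙ (ρ ∙ π)) · x)
              (·-cong τ (ρ · π · x) ((ρ ∙ π) · x) (≈-sym ((ρ ∙ π) · x) (ρ · π · x) (·-∙ ρ π x)))
              (≈-sym ((τ ∙ (ρ ∙ π)) · x) (τ · (ρ ∙ π) · x) (·-∙ τ (ρ ∙ π) x)))
            (≈-trans ((τ ∙ (ρ ∙ π)) · x) (σ · x) z
              (Supports-agree x (proj₁ least) (τ ∙ (ρ ∙ π)) σ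
                (λ b b∈N → proj₂ ext (∈-++⁺ʳ (map inj₁ D) (∈-map⁺ inj₂ b∈N))))
              (≈-sym z (σ · x) z≈σx)))

    -- Transfer along `ρ` gives one inclusion; `ρ ⁻¹` matches `H` with `G` and gives the other.
    Matches⇒SameOrbit : ∀ ρ → Fixes A ρ → ∀ G H → Matches ρ G H → SameOrbit A (ultrafilter G) (ultrafilter H)
    Matches⇒SameOrbit ρ Fρ G H match = ρ , Fρ , ⊆-antisym
      (IsSet-· ρ (IsUltrafilter.isSet (ult G))) (IsUltrafilter.isSet (ult H))
      (λ S S∈ρG → ∈-respˡ (ultrafilter H) (·-inverseʳ ρ S)
        (transfer ρ Fρ G H match (ρ ⁻¹ · S) (∈-·⁻ ρ S (ultrafilter G) S∈ρG)))
      (λ S S∈H → ∈-·⁺ ρ S (ultrafilter G) (transfer (ρ ⁻¹) (Fixes-⁻¹ {π = ρ} Fρ) H G match⁻¹ S S∈H))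
      where
      match⁻¹ : Matches (ρ ⁻¹) H G
      match⁻¹ b∈N = let e , e′ = match b∈N in
        trans (cong (inv ρ) (sym e)) (inverseˡ ρ _) , λ s → sym (e′ s)

    point : Germ x N → ℚ ⊎ ℚ → ℚ
    point G = Sum.[ (λ a → a) , limit G ]

    points : List (ℚ ⊎ ℚ)
    points = map inj₁ A ++ map inj₂ N

    -- The finite data that classify a germ: the values of its shapes, and the order type of its
    -- limits together with the points of `A`.
    Test : Set
    Test = (ℚ × Ord) ⊎ ((ℚ ⊎ ℚ) × (ℚ ⊎ ℚ))

    test : Germ x N → Test → Ord
    test G (inj₁ (b , s)) = shape G b s
    test G (inj₂ (i , j)) = cmp (point G i) (point G j)

    tests : List Test
    tests = map inj₁ (cartesianProduct N (lt ∷ eq ∷ gt ∷ [])) ++ map inj₂ (cartesianProduct points points)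

    -- Equal order types extend to an automorphism `ρ` carrying the limits of `G` to those of `H`.
    -- It fixes `A` because points of `A` stand for themselves in both configurations.
    tests⇒SameOrbit : ∀ G H → (∀ t → t ∈ₗ tests → test G t ≡ test H t) → SameOrbit A (ultrafilter G) (ultrafilter H)
    tests⇒SameOrbit G H agree = Matches⇒SameOrbit ρ
      (λ a a∈A → proj₂ ext (∈-++⁺ˡ (∈-map⁺ inj₁ a∈A))) G H
      λ {b} b∈N → proj₂ ext (∈-++⁺ʳ (map inj₁ A) (∈-map⁺ inj₂ b∈N)) , λ s →
        agree (inj₁ (b , s)) (∈-++⁺ˡ (∈-map⁺ inj₁ (∈-cartesianProduct⁺ b∈N (∈-Ord s))))
      where
      ext = extend-family points (point G) (point H) λ {i} {j} i∈ j∈ →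
        agree (inj₂ (i , j)) (∈-++⁺ʳ (map inj₁ (cartesianProduct N (lt ∷ eq ∷ gt ∷ []))) (∈-map⁺ inj₂ (∈-cartesianProduct⁺ i∈ j∈)))
      ρ = proj₁ ext
      ∈-Ord : ∀ s → s ∈ₗ lt ∷ eq ∷ gt ∷ []
      ∈-Ord lt = here refl
      ∈-Ord eq = there (here refl)
      ∈-Ord gt = there (there (here refl))

  -- Definability of the compactification

  FSUltrafilter : V → Set₁
  FSUltrafilter U = IsUltrafilter X U × FinitelySupported U

  -- Ultrafilters containing the orbit of `x` come from germs, and germs with equal test values lie
  -- in one orbit, so one germ per realised tuple of values suffices.
  ultrafilters-on-orbits : (∀ {ℓ} → ExcludedMiddle ℓ) → ZFA𝒬 X → ∀ xs → All (_∈ X) xs →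
    ∃[ Us ] All FSUltrafilter Us ×
      (∀ U → FSUltrafilter U → Any (λ x → piece A x [] ∈ U) xs → Any (λ W → SameOrbit A W U) Us)
  ultrafilters-on-orbits em X-ZFA [] _ = [] , [] , λ _ _ ()
  ultrafilters-on-orbits em X-ZFA (x ∷ xs) (x∈X ∷ xs∈X)
    with ultrafilters-on-orbits em X-ZFA xs xs∈X | least-support em x (ZFA⇒FinitelySupported x (∈-ZFA x X x∈X X-ZFA))
  ... | Us , Us-ult , covers | N , least with representatives em {Germ x N} (test em x∈X least) (tests em x∈X least)
  ... | Gs , Gs-cover = map Germ.ultrafilter Gs ++ Us ,
      All.++⁺ (All.map⁺ (All.universal (λ G → Germ.ult G , Germ.supported G) Gs)) Us-ult , λ where
        U (ult , supp) (here O∈U) → Any.++⁺ˡ (Any.map⁺ (at-x U (germ em x∈X least U ult supp O∈U)))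
        U U-fs (there any)        → Any.++⁺ʳ (map Germ.ultrafilter Gs) (covers U U-fs any)
    where
    at-x : ∀ U → ∃[ G ] Germ.ultrafilter {x} {N} G ≡ U → Any (λ H → SameOrbit A (Germ.ultrafilter H) U) Gs
    at-x U (G , refl) = Any.map (λ {H} agree → tests⇒SameOrbit em x∈X least H G agree) (Gs-cover G)

mainTheorem12 : (∀ {ℓ} → ExcludedMiddle ℓ) →
    (X : V) → Definable X →
    ∃[ βX ] IsStoneČech X βX × Definable βX
mainTheorem12 em X X-def with Definable.finite X-def
... | A , A-supp , xs , xs∈X , xs-cover with ultrafilters-on-orbits A-supp em (Definable.inModel X-def) xs xs∈X
... | Us , Us-ult , Us-cover = βX , βX-StoneČech , record
    { isSet   = tt
    ; inModel = (A , βX-supp) , λ { (i , π , Fπ) →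
        ultrafilter-ZFA (π · lookup Us i) (in-βX⁻ _ ((i , π , Fπ) , ≈-refl _)) }
    ; finite  = A , βX-supp , Us ,
        All.tabulate (λ {U} U∈ → in-βX (Any.map (λ { refl → ε , (λ _ _ → refl) , ·-ε U }) U∈)) ,
        λ U U∈βX → covers U (in-βX⁻ U U∈βX)
    }
  where
  -- All ultrafilters together form a large type; translates of finitely many representatives are
  -- indexed by a small one, as `set` demands.
  βX : V
  βX = set (Fin (length Us) × ∃[ π ] Fixes A π) λ (i , π , _) → π · lookup Us i
  covers : ∀ U → FSUltrafilter A-supp U → Any (λ W → SameOrbit A W U) Us
  covers U (ult , supp) = Us-cover U (ult , supp) (ultra-orbit A-supp em ult xs xs∈X xs-cover)
  in-βX : ∀ {U} → Any (λ W → SameOrbit A W U) Us → U ∈ βX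
  in-βX {U} any = let π , Fπ , e = Any.lookup-index any in
    (Any.index any , π , Fπ) , ≈-sym (π · lookup Us (Any.index any)) U e
  in-βX⁻ : ∀ U → U ∈ βX → FSUltrafilter A-supp U
  in-βX⁻ U ((i , π , Fπ) , U≈πW) = let ult , supp = All.lookup Us-ult (∈-lookup i) in
    IsUltrafilter-· π (A-supp π Fπ) U≈πW ult ,
    FinitelySupported-resp (≈-sym U (π · lookup Us i) U≈πW) (FinitelySupported-· π (lookup Us i) supp)
  βX-StoneČech : IsStoneČech X βX
  βX-StoneČech = record { isSet = tt ; mem = λ U → mk⇔ (in-βX⁻ U) (in-βX ∘ covers U) }
  βX-supp : Supports A βX
  βX-supp = Closed⇒Supports tt λ { ρ Fρ U ((i , π , Fπ) , U≈πW) →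
    (i , ρ ∙ π , Fixes-∙ {π = ρ} {σ = π} Fρ Fπ) ,
    ≈-trans (ρ · U) (ρ · π · lookup Us i) ((ρ ∙ π) · lookup Us i) (·-cong ρ U (π · lookup Us i) U≈πW)
      (≈-sym ((ρ ∙ π) · lookup Us i) (ρ · π · lookup Us i) (·-∙ ρ π (lookup Us i))) }
  -- Two levels down the elements belong to `X`, which is in the model; the levels above are
  -- finitely supported by assumption.
  ultrafilter-ZFA : ∀ U → FSUltrafilter A-supp U → ZFA𝒬 U
  ultrafilter-ZFA (atom _)  _            = tt
  ultrafilter-ZFA (set I f) (ult , supp) = supp , λ i → fss-ZFA (f i) (IsUltrafilter.elements ult (f i) (i , ≈-refl (f i)))
    where
    fss-ZFA : ∀ S → IsFSSubset X S → ZFA𝒬 S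
    fss-ZFA (atom _)  _   = tt
    fss-ZFA (set K g) fss = IsFSSubset.finitelySupported fss , λ j →
      ∈-ZFA (g j) X (IsFSSubset.subset fss (g j) (j , ≈-refl (g j))) (Definable.inModel X-def)
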